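{- For every $n\geq 4$, the star graph $S_n$ is an independent element in the poset $\mathcal{E}_n$.
   Context: All graphs are finite and simple. The star $S_n$ ($n\ge4$) is the graph on vertex set $\{1,\dots,n\}$ whose edges join $n$ to each $j\in\{1,\dots,n-1\}$. The chromatic symmetric function of a graph $G$ with vertices $v_1,\dots,v_n$ is $X_G=\sum_{\kappa}x_{\kappa(v_1)}\cdots x_{\kappa(v_n)}$, summed over all proper colorings $\kappa:V(G)\to\{1,2,3,\dots\}$; it is a homogeneous symmetric function of degree $n$ over $\mathbb{Q}$. Let $e_\lambda=e_{\lambda_1}e_{\lambda_2}\cdots$ be the elementary symmetric functions; $[e_\lambda]F$ denotes the coefficient of $e_\lambda$ in $F$ expanded in this basis, and $F$ is $e$-positive if $[e_\lambda]F\ge 0$ for all $\lambda$. For connected graphs $G,H$ on $n$ vertices (for which $[e_{(n)}]X_G$ and $[e_{(n)}]X_H$ are positive), set $$X_e(G,H)=X_G-\frac{[e_{(n)}]X_G}{[e_{(n)}]X_H}X_H.$$ $\mathcal{E}_n$ is the poset whose elements are the equivalence classes of connected graphs on $n$ vertices under $G\sim H\iff X_G=X_H$, ordered by $G\geq_e H$ if and only if $X_e(G,H)$ is $e$-positive. An element of a poset is called independent if it is not comparable to any other element of the poset. -}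

module Defs where

open import Data.Fin.Base using (Fin; toℕ; fromℕ)
open import Data.Fin.Properties as Fin using (toℕ-fromℕ)
open import Data.List.Base using (List; []; _∷_; [_]; length; map; concatMap; foldr;
                                  filter; tabulate; allFin; upTo; cartesianProductWith)
open import Data.List.Membership.Propositional using (_∈_)
open import Data.List.Properties using (≡-dec)
open import Data.List.Relation.Unary.All using (all?)
open import Data.List.Relation.Unary.Linked using (linked?)
open import Data.Bool.Base using (if_then_else_)
open import Data.Nat.Base as ℕ using (ℕ; zero; suc; _∸_)
open import Data.Nat.ListAction using (sum)
import Data.Nat.Properties as ℕ
open import Data.Product.Base using (Σ; _×_; _,_)
open import Data.Rational.Base using (ℚ; 0ℚ; 1ℚ; _+_; _-_; _*_; _÷_; _≤_; NonZero)
open import Data.Sum.Base using (_⊎_; inj₁; inj₂; swap)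
open import Data.Vec.Base as Vec using (Vec; []; _∷_)
open import Function.Base using (_∘_)
open import Level using (Level; 0ℓ; _⊔_)
open import Relation.Binary.Core using (Rel)
open import Relation.Binary.Definitions using (Decidable; Symmetric; Irreflexive)
open import Relation.Binary.Construct.Closure.ReflexiveTransitive using (Star; ε; _◅_)
open import Relation.Binary.PropositionalEquality using (_≡_; _≢_; refl; sym; cong)
open import Relation.Nullary using (¬_; Dec; does; yes; no)
open import Relation.Nullary.Decidable using (_×-dec_; _⊎-dec_; _→-dec_; ¬?)

record Graph (n : ℕ) : Set₁ where
  field
    Adj     : Rel (Fin n) 0ℓ
    adj?    : Decidable Adj
    symm    : Symmetric Adj
    irrefl  : Irreflexive _≡_ Adj

Connected : ∀ {n} → Graph n → Set
Connected G = ∀ u v → Star (Graph.Adj G) u v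

record ConnectedGraph (n : ℕ) : Set₁ where
  field
    graph     : Graph n
    connected : Connected graph

open ConnectedGraph public

-- Vertices are numbered from 0 in Fin n, so vertex "n" is the v with suc (toℕ v) ≡ n.

IsCentre : ∀ {n} → Fin n → Set
IsCentre {n} v = suc (toℕ v) ≡ n

star : ∀ n → Graph n
star n = record
  { Adj    = λ u v → u ≢ v × (IsCentre u ⊎ IsCentre v)
  ; adj?   = λ u v → ¬? (u Fin.≟ v) ×-dec
                     ((suc (toℕ u) ℕ.≟ n) ⊎-dec (suc (toℕ v) ℕ.≟ n))
  ; symm   = λ { (u≢v , c) → (u≢v ∘ sym) , swap c }
  ; irrefl = λ { refl (u≢u , _) → u≢u refl }
  }

star-connected : ∀ n → Connected (star n)
star-connected (suc n) u v = path u v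
  where
  c : Fin (suc n)
  c = fromℕ n

  centre : IsCentre c
  centre = cong suc (toℕ-fromℕ n)

  fromCentre : Star (Graph.Adj (star (suc n))) c v
  fromCentre with c Fin.≟ v
  ... | yes refl = ε
  ... | no c≢v   = (c≢v , inj₁ centre) ◅ ε

  path : ∀ u v → Star (Graph.Adj (star (suc n))) u v
  path u w with u Fin.≟ c | c Fin.≟ w
  ... | yes refl | yes refl = ε
  ... | yes refl | no c≢w   = (c≢w , inj₁ centre) ◅ ε
  ... | no u≢c   | yes refl = (u≢c , inj₂ centre) ◅ ε
  ... | no u≢c   | no c≢w   = (u≢c , inj₂ centre) ◅ (c≢w , inj₁ centre) ◅ ε

starGraph : ∀ n → ConnectedGraph n
starGraph n = record { graph = star n ; connected = star-connected n }

-- Formal power series over ℚ in x₁, x₂, x₃, …, as coefficient functions.  The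
-- list α₁ ∷ … ∷ αₖ ∷ [] is the exponent of the monomial x₁^α₁ ⋯ xₖ^αₖ.  Lists
-- differing by trailing zeros name the same monomial; every series below takes
-- the same value on them.

Series : Set
Series = List ℕ → ℚ

infix 4 _≐_
_≐_ : Rel Series 0ℓ
F ≐ G = ∀ α → F α ≡ G α

private variable
  a p ℓ₁ ℓ₂ : Level

indicator : {P : Set p} → Dec P → ℚ
indicator P? = if does P? then 1ℚ else 0ℚ

∑ : {A : Set a} → List A → (A → ℚ) → ℚ
∑ xs f = foldr _+_ 0ℚ (map f xs)

infixl 6 _⊖_
_⊖_ : Series → Series → Series
(F ⊖ G) α = F α - G α

infixr 7 _·_
_·_ : ℚ → Series → Series
(q · F) α = q * F α

-- All pairs (β , γ) of exponents of the same length with β + γ = α.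
splittings : List ℕ → List (List ℕ × List ℕ)
splittings []      = [ [] , [] ]
splittings (m ∷ α) =
  cartesianProductWith (λ { i (β , γ) → (i ∷ β) , (m ∸ i ∷ γ) }) (upTo (suc m)) (splittings α)

infixl 7 _⊛_
_⊛_ : Series → Series → Series
(F ⊛ G) α = ∑ (splittings α) λ { (β , γ) → F β * G γ }

𝟙 : Series
𝟙 α = indicator (all? (ℕ._≟ 0) α)

-- e_r is the sum of all squarefree monomials of degree r.
e : ℕ → Series
e r α = indicator (all? (ℕ._≤? 1) α ×-dec (sum α ℕ.≟ r))

e[_] : List ℕ → Series
e[ μ ] = foldr _⊛_ 𝟙 (map e μ)

-- Lists of positive integers with sum n: the first part of a composition of
-- n + 1 is either a new part 1 or one more than that of a composition of n.
compositions : ℕ → List (List ℕ)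
compositions zero    = [ [] ]
compositions (suc n) = concatMap grow (compositions n)
  where
  grow : List ℕ → List (List ℕ)
  grow []      = [ [ 1 ] ]
  grow (m ∷ μ) = (1 ∷ m ∷ μ) ∷ (suc m ∷ μ) ∷ []

partitions : ℕ → List (List ℕ)
partitions n = filter (linked? ℕ._≥?_) (compositions n)

-- The expansion F = Σ_{μ ⊢ n} [e_μ]F · e_μ of F in the e-basis.  As the e_μ with
-- μ ⊢ n form a ℚ-basis of the symmetric functions of degree n, each such F has
-- exactly one expansion: coeff is determined on partitions n, and its values
-- elsewhere are irrelevant.
record EExpansion (n : ℕ) (F : Series) : Set where
  field
    coeff   : List ℕ → ℚ
    expands : F ≐ λ α → ∑ (partitions n) λ μ → coeff μ * e[ μ ] α

open EExpansion public

EPositive : ℕ → Series → Set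
EPositive n F = Σ (EExpansion n F) λ E → ∀ {μ} → μ ∈ partitions n → 0ℚ ≤ coeff E μ

colourings : ∀ n k → List (Vec (Fin k) n)
colourings zero    k = [ [] ]
colourings (suc n) k = cartesianProductWith _∷_ (allFin k) (colourings n k)

module _ {n : ℕ} (G : Graph n) {k : ℕ} where
  open Graph G

  Proper : Vec (Fin k) n → Set
  Proper κ = ∀ u v → Adj u v → Vec.lookup κ u ≢ Vec.lookup κ v

  proper? : ∀ κ → Dec (Proper κ)
  proper? κ = Fin.all? λ u → Fin.all? λ v →
              adj? u v →-dec ¬? (Vec.lookup κ u Fin.≟ Vec.lookup κ v)

-- The exponent of the monomial x_{κ(v₁)} ⋯ x_{κ(vₙ)}.
exponent : ∀ {n k} → Vec (Fin k) n → List ℕ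
exponent κ = tabulate λ i → Vec.count (i Fin.≟_) κ

-- Only the variables x₁, …, xₖ with k = length α occur in the monomial with
-- exponent α, so only colourings with colours 1, …, k contribute to it.
X : ∀ {n} → Graph n → Series
X {n} G α = ∑ (filter (proper? G) (colourings n (length α))) λ κ →
            indicator (≡-dec ℕ._≟_ (exponent κ) α)

infix 4 _∼_ _≥ₑ_

_∼_ : ∀ {n} → Rel (ConnectedGraph n) 0ℓ
G ∼ H = X (graph G) ≐ X (graph H)

-- G ≥ₑ H: the series X_G - ([e_(n)]X_G / [e_(n)]X_H) X_H is e-positive.  The
-- expansions of X_G and X_H are unique, and nonzero only makes the quotient
-- well formed: [e_(n)]X_H > 0 because H is connected.
record _≥ₑ_ {n : ℕ} (G H : ConnectedGraph n) : Set where
  field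
    expansionᴳ  : EExpansion n (X (graph G))
    expansionᴴ  : EExpansion n (X (graph H))
    {{nonzero}} : NonZero (coeff expansionᴴ [ n ])

  Xₑ : Series
  Xₑ = X (graph G) ⊖ (coeff expansionᴳ [ n ] ÷ coeff expansionᴴ [ n ]) · X (graph H)

  field
    e-positive : EPositive n Xₑ

-- Posets are given by an underlying equality _≈_ and an order _≥_, so that the
-- classes of ∼ need not be formed as a type.
Independent : {A : Set a} → Rel A ℓ₁ → Rel A ℓ₂ → A → Set (a ⊔ ℓ₁ ⊔ ℓ₂)
Independent _≈_ _≥_ x = ∀ y → ¬ (x ≈ y) → ¬ (x ≥ y ⊎ y ≥ x)

{-# OPTIONS --safe #-}

-- For a graph G let S = Σ (-1)^|A| y^A over the stable sets A, with one variable
-- y_v per vertex v, and put p_v = - y_v ∂_v S / S.  The coefficient of y^V in a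
-- product of homogeneous parts of Σ y^A is a coefficient of X_G, and for edgeless
-- G the coefficient of y^μ is a coefficient of e_μ; hence polynomial expressions
-- in the homogeneous parts of S give linear functionals that can be evaluated on
-- X_G and on e_μ alike.
--
-- The p_v have nonnegative coefficients: no stable set contains both ends of an
-- edge vw, so y_w ∂_w p_v = p_v p_w, which also shows that the coefficient of y^U
-- is positive when U induces a connected subgraph.  When v is isolated in a larger
-- support the coefficient vanishes.  Thus Σ_v p_v is positive on X_G for connected
-- G and kills every e_μ with μ ≠ (n), so [e_(n)]X_G > 0.  The functional of
-- Σ p_v p_w, restricted to parts of degree at least 2, is nonnegative on every e_μ
-- and vanishes on the star, but is positive on any other connected graph, because
-- such a graph has two disjoint edges, which grow to a partition into two connected
-- parts.  Conversely the coefficient of x₁ⁿ⁻¹x₂, also nonnegative on every e_μ, is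
-- positive for the star and zero for any other connected graph.

module Submission where

open import Defs
open import Algebra.Solver.Ring.AlmostCommutativeRing using (fromCommutativeRing)
import Algebra.Properties.CommutativeSemigroup as CommutativeSemigroupProperties
import Algebra.Solver.Ring.Simple as RingSolver
open import Data.Bool.Base using (true; false; if_then_else_)
open import Data.Empty using (⊥; ⊥-elim)
open import Data.Fin.Base as Fin using (Fin; zero; suc; toℕ; fromℕ; fromℕ<)
import Data.Fin.Properties as Fin
open import Data.List.Base using (List; []; _∷_; [_]; _++_; length; lookup; map; foldr; filter; replicate; tabulate; allFin; upTo; applyUpTo; cartesianProductWith)
open import Data.List.Membership.Propositional using (_∈_; find)
open import Data.List.Membership.Propositional.Properties using (∈-allFin; ∈-cartesianProductWith⁺; ∈-cartesianProductWith⁻; ∈-concatMap⁻; ∈-filter⁻; ∈-upTo⁺; ∈-upTo⁻)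
open import Data.List.Properties using (length-replicate; map-tabulate; map-upTo; tabulate-cong; tabulate-lookup; ∷-injective; ≡-dec)
open import Data.List.Relation.Binary.Permutation.Propositional as Perm using (_↭_; ↭-sym)
open import Data.List.Relation.Binary.Permutation.Propositional.Properties using (All-resp-↭; ↭-length)
open import Data.List.Relation.Unary.All as All using (All; []; _∷_; all?)
open import Data.List.Relation.Unary.Any using (here; there)
open import Data.Nat.Base as ℕ using (ℕ; zero; suc; _≥_; _∸_; z≤n; s≤s; s≤s⁻¹)
open import Data.Nat.ListAction using (sum)
open import Data.Nat.ListAction.Properties using (sum-↭)
import Data.Nat.Properties as ℕ
open import Data.Product.Base using (∃; ∃₂; _×_; _,_; proj₁; proj₂)
open import Data.Rational.Base using (ℚ; 0ℚ; 1ℚ; _+_; _-_; _*_; -_; _÷_; _≤_; _<_; NonZero; positive; nonNegative)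
import Data.Rational.Properties as ℚ
open import Data.Sum.Base using (_⊎_; inj₁; inj₂; [_,_]′)
open import Data.Vec.Base as Vec using (Vec; []; _∷_)
open import Function.Base using (_∘_; id)
open import Level using (Level)
open import Relation.Binary.Construct.Closure.ReflexiveTransitive using (Star; ε; _◅_)
open import Relation.Binary.PropositionalEquality using (_≡_; _≢_; refl; sym; trans; cong; cong₂; cong-app; subst; subst₂; module ≡-Reasoning)
open import Relation.Nullary using (¬_; Dec; yes; no; does)
open import Relation.Nullary.Decidable using (_×-dec_; _⊎-dec_; _→-dec_; ¬?)

open ≡-Reasoning

-- A functional is a single list of coefficients used for all graphs, so it cannot single out a
-- vertex. The sum of all p_v is admissible because the sum of the operators y_v ∂_v multiplies the
-- part of degree i by i. On an edgeless graph this is Newton's formula for the power sums in terms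
-- of the elementary symmetric functions: S is the product of the 1 - y_v, so p_v = y_v + y_v² + ⋯
-- and no mixed monomial occurs.
--
-- The coefficient of x^α in e_μ counts 0-1 matrices with row sums μ and column sums α, hence is
-- symmetric in α and μ. The parts of μ thus become the vertices of an edgeless graph, and the
-- evaluation is at y^μ instead of at the squarefree y^V. This is why exponents are lists of
-- arbitrary naturals and the p_v are controlled at exponents above 1 as well.

module ℕ+ = CommutativeSemigroupProperties ℕ.+-commutativeSemigroup

open RingSolver (fromCommutativeRing ℚ.+-*-commutativeRing) ℚ._≟_
  using (solve; _:=_; _:+_; _:*_; :-_; con)

private variable
  ℓ : Level
  A B C : Set ℓ

-- Finite sums

∑-cong-∈ : ∀ (xs : List A) {f g : A → ℚ} → (∀ {x} → x ∈ xs → f x ≡ g x) → ∑ xs f ≡ ∑ xs g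
∑-cong-∈ []       eq = refl
∑-cong-∈ (x ∷ xs) eq = cong₂ _+_ (eq (here refl)) (∑-cong-∈ xs (eq ∘ there))

∑-cong : ∀ (xs : List A) {f g : A → ℚ} → (∀ x → f x ≡ g x) → ∑ xs f ≡ ∑ xs g
∑-cong xs eq = ∑-cong-∈ xs (λ {x} _ → eq x)

∑-zero : ∀ (xs : List A) {f : A → ℚ} → (∀ {x} → x ∈ xs → f x ≡ 0ℚ) → ∑ xs f ≡ 0ℚ
∑-zero []       eq = refl
∑-zero (x ∷ xs) eq = trans (cong₂ _+_ (eq (here refl)) (∑-zero xs (eq ∘ there))) (ℚ.+-identityˡ 0ℚ)

+-interchange : ∀ p q r s → (p + q) + (r + s) ≡ (p + r) + (q + s)
+-interchange = solve 4 (λ p q r s → ((p :+ q) :+ (r :+ s)) := ((p :+ r) :+ (q :+ s))) refl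

∑-+ : ∀ (xs : List A) (f g : A → ℚ) → ∑ xs (λ x → f x + g x) ≡ ∑ xs f + ∑ xs g
∑-+ []       f g = sym (ℚ.+-identityˡ 0ℚ)
∑-+ (x ∷ xs) f g = trans (cong (f x + g x +_) (∑-+ xs f g)) (+-interchange (f x) (g x) _ _)

∑-*ˡ : ∀ (xs : List A) c (f : A → ℚ) → ∑ xs (λ x → c * f x) ≡ c * ∑ xs f
∑-*ˡ []       c f = sym (ℚ.*-zeroʳ c)
∑-*ˡ (x ∷ xs) c f = trans (cong (c * f x +_) (∑-*ˡ xs c f)) (sym (ℚ.*-distribˡ-+ c (f x) _))

∑-*ʳ : ∀ (xs : List A) c (f : A → ℚ) → ∑ xs (λ x → f x * c) ≡ ∑ xs f * c
∑-*ʳ xs c f = trans (∑-cong xs λ x → ℚ.*-comm (f x) c) (trans (∑-*ˡ xs c f) (ℚ.*-comm c _))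

∑-++ : ∀ (xs ys : List A) (f : A → ℚ) → ∑ (xs ++ ys) f ≡ ∑ xs f + ∑ ys f
∑-++ []       ys f = sym (ℚ.+-identityˡ _)
∑-++ (x ∷ xs) ys f = trans (cong (f x +_) (∑-++ xs ys f)) (sym (ℚ.+-assoc (f x) _ _))

∑-map : ∀ (h : A → B) xs (f : B → ℚ) → ∑ (map h xs) f ≡ ∑ xs (f ∘ h)
∑-map h []       f = refl
∑-map h (x ∷ xs) f = cong (f (h x) +_) (∑-map h xs f)

∑-swap : ∀ (xs : List A) (ys : List B) (f : A → B → ℚ) →
         ∑ xs (λ x → ∑ ys (f x)) ≡ ∑ ys (λ y → ∑ xs (λ x → f x y))
∑-swap []       ys f = sym (∑-zero ys (λ _ → refl))
∑-swap (x ∷ xs) ys f = trans (cong (∑ ys (f x) +_) (∑-swap xs ys f)) (sym (∑-+ ys (f x) _))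

∑-cartesianProductWith : ∀ (h : A → B → C) xs ys (f : C → ℚ) →
  ∑ (cartesianProductWith h xs ys) f ≡ ∑ xs (λ x → ∑ ys (λ y → f (h x y)))
∑-cartesianProductWith h []       ys f = refl
∑-cartesianProductWith h (x ∷ xs) ys f = trans (∑-++ (map (h x) ys) _ f)
  (cong₂ _+_ (∑-map (h x) ys f) (∑-cartesianProductWith h xs ys f))

∑-applyUpTo : ∀ (h : ℕ → A) n (f : A → ℚ) → ∑ (applyUpTo h n) f ≡ ∑ (upTo n) (f ∘ h)
∑-applyUpTo h n f = trans (cong (λ xs → ∑ xs f) (sym (map-upTo h n))) (∑-map h (upTo n) f)

∑-upTo-suc : ∀ n (f : ℕ → ℚ) → ∑ (upTo (suc n)) f ≡ f 0 + ∑ (upTo n) (f ∘ suc)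
∑-upTo-suc n f = cong (f 0 +_) (∑-applyUpTo suc n f)

∑-allFin-suc : ∀ n (f : Fin (suc n) → ℚ) → ∑ (allFin (suc n)) f ≡ f zero + ∑ (allFin n) (f ∘ suc)
∑-allFin-suc n f = cong (f zero +_) (trans (cong (λ xs → ∑ xs f) (sym (map-tabulate id suc))) (∑-map suc (allFin n) f))

+-nonneg : ∀ {p q} → 0ℚ ≤ p → 0ℚ ≤ q → 0ℚ ≤ p + q
+-nonneg {p} {q} p≥0 q≥0 = subst (_≤ p + q) (ℚ.+-identityˡ 0ℚ) (ℚ.+-mono-≤ p≥0 q≥0)

*-nonneg : ∀ {p q} → 0ℚ ≤ p → 0ℚ ≤ q → 0ℚ ≤ p * q
*-nonneg {p} {q} p≥0 q≥0 = ℚ.nonNegative⁻¹ (p * q)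
  {{ℚ.nonNeg*nonNeg⇒nonNeg p {{nonNegative p≥0}} q {{nonNegative q≥0}}}}

*-pos : ∀ {p q} → 0ℚ < p → 0ℚ < q → 0ℚ < p * q
*-pos {p} {q} p>0 q>0 = subst (_< p * q) (ℚ.*-zeroʳ p) (ℚ.*-monoʳ-<-pos p {{positive p>0}} q>0)

*-cancel-nonneg : ∀ {p q} → 0ℚ < p → 0ℚ ≤ p * q → 0ℚ ≤ q
*-cancel-nonneg {p} {q} p>0 pq≥0 = ℚ.*-cancelˡ-≤-pos p {{positive p>0}} (subst (_≤ p * q) (sym (ℚ.*-zeroʳ p)) pq≥0)

*-cancel-pos : ∀ {p q} → 0ℚ ≤ p → 0ℚ < p * q → 0ℚ < q
*-cancel-pos {p} {q} p≥0 pq>0 = ℚ.*-cancelˡ-<-nonNeg p {{nonNegative p≥0}} (subst (_< p * q) (sym (ℚ.*-zeroʳ p)) pq>0)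

∑-nonneg : ∀ (xs : List A) {f : A → ℚ} → (∀ {x} → x ∈ xs → 0ℚ ≤ f x) → 0ℚ ≤ ∑ xs f
∑-nonneg []       f≥0 = ℚ.≤-refl
∑-nonneg (x ∷ xs) f≥0 = +-nonneg (f≥0 (here refl)) (∑-nonneg xs (f≥0 ∘ there))

∑-pos : ∀ {xs : List A} {f : A → ℚ} → (∀ {x} → x ∈ xs → 0ℚ ≤ f x) →
        ∀ {x} → x ∈ xs → 0ℚ < f x → 0ℚ < ∑ xs f
∑-pos {xs = _ ∷ xs} {f} f≥0 {x} (here refl) fx>0 = subst (_< f x + ∑ xs f) (ℚ.+-identityˡ 0ℚ)
  (ℚ.+-mono-<-≤ fx>0 (∑-nonneg xs (f≥0 ∘ there)))
∑-pos {xs = y ∷ xs} {f} f≥0 (there x∈) fx>0 = subst (_< f y + ∑ xs f) (ℚ.+-identityˡ 0ℚ)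
  (ℚ.+-mono-≤-< (f≥0 (here refl)) (∑-pos (f≥0 ∘ there) x∈ fx>0))

module _ {P : Set ℓ} where
  indicator-true : (P? : Dec P) → P → indicator P? ≡ 1ℚ
  indicator-true (yes _) _ = refl
  indicator-true (no ¬p) p = ⊥-elim (¬p p)

  indicator-false : (P? : Dec P) → ¬ P → indicator P? ≡ 0ℚ
  indicator-false (yes p) ¬p = ⊥-elim (¬p p)
  indicator-false (no _)  _  = refl

  indicator-nonneg : (P? : Dec P) → 0ℚ ≤ indicator P?
  indicator-nonneg (yes _) = ℚ.nonNegative⁻¹ 1ℚ
  indicator-nonneg (no _)  = ℚ.≤-refl

indicator-⇔ : ∀ {ℓ₁ ℓ₂} {P : Set ℓ₁} {Q : Set ℓ₂} (P? : Dec P) (Q? : Dec Q) → (P → Q) → (Q → P) →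
              indicator P? ≡ indicator Q?
indicator-⇔ P? (yes q) f g = indicator-true P? (g q)
indicator-⇔ P? (no ¬q) f g = indicator-false P? (¬q ∘ f)

0<1 : 0ℚ < 1ℚ
0<1 = ℚ.positive⁻¹ 1ℚ

ι : ℕ → ℚ
ι zero    = 0ℚ
ι (suc n) = 1ℚ + ι n

ι-+ : ∀ m n → ι (m ℕ.+ n) ≡ ι m + ι n
ι-+ zero    n = sym (ℚ.+-identityˡ _)
ι-+ (suc m) n = trans (cong (1ℚ +_) (ι-+ m n)) (sym (ℚ.+-assoc 1ℚ (ι m) (ι n)))

ι-nonneg : ∀ n → 0ℚ ≤ ι n
ι-nonneg zero    = ℚ.≤-refl
ι-nonneg (suc n) = +-nonneg (ℚ.nonNegative⁻¹ 1ℚ) (ι-nonneg n)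

ι-pos : ∀ {n} → 1 ℕ.≤ n → 0ℚ < ι n
ι-pos {suc n} _ = subst (_< 1ℚ + ι n) (ℚ.+-identityˡ 0ℚ) (ℚ.+-mono-<-≤ 0<1 (ι-nonneg n))

-- The product of series

-- Lists are read as extended by zeros, but bump i is the identity on lists of length ≤ i.
at : List ℕ → ℕ → ℕ
at []      _       = 0
at (m ∷ α) zero    = m
at (m ∷ α) (suc i) = at α i

bump : ℕ → List ℕ → List ℕ
bump _       []      = []
bump zero    (m ∷ α) = suc m ∷ α
bump (suc i) (m ∷ α) = m ∷ bump i α

record Split (α β γ : List ℕ) : Set where
  constructor split
  field
    at-split  : ∀ i → at β i ℕ.+ at γ i ≡ at α i
    sum-split : sum β ℕ.+ sum γ ≡ sum α
    lengthˡ   : length β ≡ length α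
    lengthʳ   : length γ ≡ length α

split-∈ : ∀ α {β γ} → (β , γ) ∈ splittings α → Split α β γ
split-∈ []      (here refl) = split (λ _ → refl) refl refl refl
split-∈ (m ∷ α) ∈α with ∈-cartesianProductWith⁻ _ (upTo (suc m)) (splittings α) ∈α
... | i , (β , γ) , i∈ , βγ∈ , refl = split
  (λ { zero → i+ ; (suc j) → at-split j })
  (trans (ℕ+.interchange i (sum β) (m ∸ i) (sum γ)) (cong₂ ℕ._+_ i+ sum-split))
  (cong suc lengthˡ) (cong suc lengthʳ)
  where
  open Split (split-∈ α βγ∈)
  i+ : i ℕ.+ (m ∸ i) ≡ m
  i+ = ℕ.m+[n∸m]≡n (s≤s⁻¹ (∈-upTo⁻ i∈))

infixl 6 _⊕_
_⊕_ : Series → Series → Series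
(F ⊕ G) α = F α + G α

-- The product of series is sealed so that its factors can be inferred.
infixl 7 _✶_
opaque
  _✶_ : Series → Series → Series
  _✶_ = _⊛_

  ✶≡⊛ : ∀ F G → F ✶ G ≡ F ⊛ G
  ✶≡⊛ F G = refl

  ✶-split : ∀ F G α → (F ✶ G) α ≡ ∑ (splittings α) λ βγ → F (proj₁ βγ) * G (proj₂ βγ)
  ✶-split F G α = refl

  ✶-[] : ∀ F G → (F ✶ G) [] ≡ F [] * G []
  ✶-[] F G = ℚ.+-identityʳ _

  ✶-∷ : ∀ F G m α → (F ✶ G) (m ∷ α) ≡ ∑ (upTo (suc m)) λ i → ((F ∘ (i ∷_)) ✶ (G ∘ (m ∸ i ∷_))) α
  ✶-∷ F G m α = ∑-cartesianProductWith _ (upTo (suc m)) (splittings α) _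

  ✶-zero : ∀ {F G} α → (∀ {β γ} → Split α β γ → F β * G γ ≡ 0ℚ) → (F ✶ G) α ≡ 0ℚ
  ✶-zero α eq = ∑-zero (splittings α) (λ βγ∈ → eq (split-∈ α βγ∈))

  ✶-nonneg : ∀ {F G} α → (∀ {β γ} → Split α β γ → 0ℚ ≤ F β * G γ) → 0ℚ ≤ (F ✶ G) α
  ✶-nonneg α FG≥0 = ∑-nonneg (splittings α) (λ βγ∈ → FG≥0 (split-∈ α βγ∈))

  ✶-pos : ∀ {F G} α → (∀ {β γ} → Split α β γ → 0ℚ ≤ F β * G γ) →
          ∀ {β γ} → (β , γ) ∈ splittings α → 0ℚ < F β * G γ → 0ℚ < (F ✶ G) α
  ✶-pos α FG≥0 βγ∈ = ∑-pos (λ βγ∈ → FG≥0 (split-∈ α βγ∈)) βγ∈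

  ✶-cong-∈ : ∀ {F F′ G G′} α →
    (∀ {β γ} → Split α β γ → F β * G γ ≡ F′ β * G′ γ) → (F ✶ G) α ≡ (F′ ✶ G′) α
  ✶-cong-∈ α eq = ∑-cong-∈ (splittings α) (λ βγ∈ → eq (split-∈ α βγ∈))

  ✶-distribʳ : ∀ F G H → (F ⊕ G) ✶ H ≐ (F ✶ H) ⊕ (G ✶ H)
  ✶-distribʳ F G H α = trans (∑-cong (splittings α) λ { (β , γ) → ℚ.*-distribʳ-+ (H γ) (F β) (G β) })
    (∑-+ (splittings α) _ _)

  ✶-distribˡ : ∀ F G H → F ✶ (G ⊕ H) ≐ (F ✶ G) ⊕ (F ✶ H)
  ✶-distribˡ F G H α = trans (∑-cong (splittings α) λ { (β , γ) → ℚ.*-distribˡ-+ (F β) (G γ) (H γ) })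
    (∑-+ (splittings α) _ _)

  ✶-·ˡ : ∀ c F G → (c · F) ✶ G ≐ c · (F ✶ G)
  ✶-·ˡ c F G α = trans (∑-cong (splittings α) λ { (β , γ) → ℚ.*-assoc c (F β) (G γ) })
    (∑-*ˡ (splittings α) c _)

  ✶-∑ˡ : ∀ (xs : List A) (F : A → Series) G α → ((λ β → ∑ xs (λ x → F x β)) ✶ G) α ≡ ∑ xs (λ x → (F x ✶ G) α)
  ✶-∑ˡ xs F G α = trans
    (∑-cong (splittings α) λ { (β , γ) → sym (∑-*ʳ xs (G γ) (λ x → F x β)) })
    (∑-swap (splittings α) xs _)

  ✶-∑ʳ : ∀ (xs : List A) F (G : A → Series) α → (F ✶ (λ β → ∑ xs (λ x → G x β))) α ≡ ∑ xs (λ x → (F ✶ G x) α)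
  ✶-∑ʳ xs F G α = trans
    (∑-cong (splittings α) λ { (β , γ) → sym (∑-*ˡ xs (F β) (λ x → G x γ)) })
    (∑-swap (splittings α) xs _)

✶-0∷ : ∀ F G α → (F ✶ G) (0 ∷ α) ≡ ((F ∘ (0 ∷_)) ✶ (G ∘ (0 ∷_))) α
✶-0∷ F G α = trans (✶-∷ F G 0 α) (ℚ.+-identityʳ _)

-- Either the left factor omits the first variable, or one power of it can be taken out of that
-- factor: `F ∘ bump 0` is the part of `F` divisible by x₁, divided by x₁. The remaining exponent is
-- smaller, which is what the inductions for commutativity and associativity run on.
✶-suc∷ : ∀ F G m α → (F ✶ G) (suc m ∷ α) ≡
         ((F ∘ (0 ∷_)) ✶ (G ∘ (suc m ∷_))) α + ((F ∘ bump 0) ✶ G) (m ∷ α)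
✶-suc∷ F G m α = begin
  (F ✶ G) (suc m ∷ α)
    ≡⟨ ✶-∷ F G (suc m) α ⟩
  ∑ (upTo (suc (suc m))) (λ i → ((F ∘ (i ∷_)) ✶ (G ∘ (suc m ∸ i ∷_))) α)
    ≡⟨ ∑-upTo-suc (suc m) (λ i → ((F ∘ (i ∷_)) ✶ (G ∘ (suc m ∸ i ∷_))) α) ⟩
  ((F ∘ (0 ∷_)) ✶ (G ∘ (suc m ∷_))) α + ∑ (upTo (suc m)) (λ i → ((F ∘ (suc i ∷_)) ✶ (G ∘ (m ∸ i ∷_))) α)
    ≡⟨ cong (((F ∘ (0 ∷_)) ✶ (G ∘ (suc m ∷_))) α +_) (sym (✶-∷ (F ∘ bump 0) G m α)) ⟩
  ((F ∘ (0 ∷_)) ✶ (G ∘ (suc m ∷_))) α + ((F ∘ bump 0) ✶ G) (m ∷ α) ∎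

✶-cong : ∀ {F F′ G G′} → F ≐ F′ → G ≐ G′ → F ✶ G ≐ F′ ✶ G′
✶-cong F≐ G≐ α = ✶-cong-∈ α (λ {β} {γ} _ → cong₂ _*_ (F≐ β) (G≐ γ))

✶-suc∷ʳ : ∀ F G m α → (F ✶ G) (suc m ∷ α) ≡
          ((F ∘ (suc m ∷_)) ✶ (G ∘ (0 ∷_))) α + (F ✶ (G ∘ bump 0)) (m ∷ α)
✶-suc∷ʳ F G zero α = begin
  (F ✶ G) (1 ∷ α)
    ≡⟨ ✶-suc∷ F G 0 α ⟩
  ((F ∘ (0 ∷_)) ✶ (G ∘ (1 ∷_))) α + ((F ∘ bump 0) ✶ G) (0 ∷ α)
    ≡⟨ cong₂ _+_ (sym (✶-0∷ F (G ∘ bump 0) α)) (✶-0∷ (F ∘ bump 0) G α) ⟩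
  (F ✶ (G ∘ bump 0)) (0 ∷ α) + ((F ∘ (1 ∷_)) ✶ (G ∘ (0 ∷_))) α
    ≡⟨ ℚ.+-comm ((F ✶ (G ∘ bump 0)) (0 ∷ α)) (((F ∘ (1 ∷_)) ✶ (G ∘ (0 ∷_))) α) ⟩
  ((F ∘ (1 ∷_)) ✶ (G ∘ (0 ∷_))) α + (F ✶ (G ∘ bump 0)) (0 ∷ α) ∎
✶-suc∷ʳ F G (suc m) α = begin
  (F ✶ G) (suc (suc m) ∷ α)
    ≡⟨ ✶-suc∷ F G (suc m) α ⟩
  x + ((F ∘ bump 0) ✶ G) (suc m ∷ α)
    ≡⟨ cong (x +_) (✶-suc∷ʳ (F ∘ bump 0) G m α) ⟩
  x + (y + z)
    ≡⟨ solve 3 (λ x y z → (x :+ (y :+ z)) := (y :+ (x :+ z))) refl x y z ⟩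
  y + (x + z)
    ≡⟨ cong (y +_) (sym (✶-suc∷ F (G ∘ bump 0) m α)) ⟩
  y + (F ✶ (G ∘ bump 0)) (suc m ∷ α) ∎
  where
  x = ((F ∘ (0 ∷_)) ✶ (G ∘ (suc (suc m) ∷_))) α
  y = ((F ∘ (suc (suc m) ∷_)) ✶ (G ∘ (0 ∷_))) α
  z = ((F ∘ bump 0) ✶ (G ∘ bump 0)) (m ∷ α)

✶-comm : ∀ F G → F ✶ G ≐ G ✶ F
✶-comm F G []          = trans (✶-[] F G) (trans (ℚ.*-comm (F []) (G [])) (sym (✶-[] G F)))
✶-comm F G (zero ∷ α)  = trans (✶-0∷ F G α) (trans (✶-comm _ _ α) (sym (✶-0∷ G F α)))
✶-comm F G (suc m ∷ α) = trans (✶-suc∷ F G m α)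
  (trans (cong₂ _+_ (✶-comm _ _ α) (✶-comm (F ∘ bump 0) G (m ∷ α))) (sym (✶-suc∷ʳ G F m α)))

✶-assoc : ∀ F G H → (F ✶ G) ✶ H ≐ F ✶ (G ✶ H)
✶-assoc F G H [] = begin
  ((F ✶ G) ✶ H) []        ≡⟨ ✶-[] (F ✶ G) H ⟩
  (F ✶ G) [] * H []       ≡⟨ cong (_* H []) (✶-[] F G) ⟩
  F [] * G [] * H []      ≡⟨ ℚ.*-assoc (F []) (G []) (H []) ⟩
  F [] * (G [] * H [])    ≡⟨ cong (F [] *_) (sym (✶-[] G H)) ⟩
  F [] * (G ✶ H) []       ≡⟨ sym (✶-[] F (G ✶ H)) ⟩
  (F ✶ (G ✶ H)) []        ∎
✶-assoc F G H (zero ∷ α) = begin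
  ((F ✶ G) ✶ H) (0 ∷ α)             ≡⟨ ✶-0∷ (F ✶ G) H α ⟩
  (((F ✶ G) ∘ (0 ∷_)) ✶ H₀) α       ≡⟨ ✶-cong {G = H₀} (✶-0∷ F G) (λ _ → refl) α ⟩
  ((F₀ ✶ G₀) ✶ H₀) α                ≡⟨ ✶-assoc F₀ G₀ H₀ α ⟩
  (F₀ ✶ (G₀ ✶ H₀)) α                ≡⟨ ✶-cong {F = F₀} (λ _ → refl) (sym ∘ ✶-0∷ G H) α ⟩
  (F₀ ✶ ((G ✶ H) ∘ (0 ∷_))) α       ≡⟨ sym (✶-0∷ F (G ✶ H) α) ⟩
  (F ✶ (G ✶ H)) (0 ∷ α)             ∎
  where
  F₀ = F ∘ (0 ∷_)
  G₀ = G ∘ (0 ∷_)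
  H₀ = H ∘ (0 ∷_)
✶-assoc F G H (suc m ∷ α) = begin
  ((F ✶ G) ✶ H) (suc m ∷ α)
    ≡⟨ ✶-suc∷ (F ✶ G) H m α ⟩
  (((F ✶ G) ∘ (0 ∷_)) ✶ Hₘ) α + (((F ✶ G) ∘ bump 0) ✶ H) (m ∷ α)
    ≡⟨ cong₂ _+_ (✶-cong {G = Hₘ} (✶-0∷ F G) (λ _ → refl) α) (✶-cong-∈ (m ∷ α) (λ {β} {γ} sp → cong (_* H γ) (tail-✶ β (Split.lengthˡ sp)))) ⟩
  ((F₀ ✶ G₀) ✶ Hₘ) α + ((F₀✶tailG ⊕ ((F ∘ bump 0) ✶ G)) ✶ H) (m ∷ α)
    ≡⟨ cong (((F₀ ✶ G₀) ✶ Hₘ) α +_) (✶-distribʳ F₀✶tailG _ H (m ∷ α)) ⟩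
  ((F₀ ✶ G₀) ✶ Hₘ) α + ((F₀✶tailG ✶ H) (m ∷ α) + (((F ∘ bump 0) ✶ G) ✶ H) (m ∷ α))
    ≡⟨ cong₂ _+_ (✶-assoc F₀ G₀ Hₘ α) (cong₂ _+_ middle (✶-assoc (F ∘ bump 0) G H (m ∷ α))) ⟩
  (F₀ ✶ (G₀ ✶ Hₘ)) α + ((F₀ ✶ (((G ∘ bump 0) ✶ H) ∘ (m ∷_))) α + ((F ∘ bump 0) ✶ (G ✶ H)) (m ∷ α))
    ≡⟨ sym (ℚ.+-assoc ((F₀ ✶ (G₀ ✶ Hₘ)) α) ((F₀ ✶ (((G ∘ bump 0) ✶ H) ∘ (m ∷_))) α) _) ⟩
  (F₀ ✶ (G₀ ✶ Hₘ)) α + (F₀ ✶ (((G ∘ bump 0) ✶ H) ∘ (m ∷_))) α + ((F ∘ bump 0) ✶ (G ✶ H)) (m ∷ α)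
    ≡⟨ cong (_+ ((F ∘ bump 0) ✶ (G ✶ H)) (m ∷ α)) (sym (✶-distribˡ F₀ _ _ α)) ⟩
  (F₀ ✶ ((G₀ ✶ Hₘ) ⊕ (((G ∘ bump 0) ✶ H) ∘ (m ∷_)))) α + ((F ∘ bump 0) ✶ (G ✶ H)) (m ∷ α)
    ≡⟨ cong (_+ ((F ∘ bump 0) ✶ (G ✶ H)) (m ∷ α)) (✶-cong {F = F₀} (λ _ → refl) (sym ∘ ✶-suc∷ G H m) α) ⟩
  (F₀ ✶ ((G ✶ H) ∘ (suc m ∷_))) α + ((F ∘ bump 0) ✶ (G ✶ H)) (m ∷ α)
    ≡⟨ sym (✶-suc∷ F (G ✶ H) m α) ⟩
  (F ✶ (G ✶ H)) (suc m ∷ α) ∎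
  where
  F₀ = F ∘ (0 ∷_)
  G₀ = G ∘ (0 ∷_)
  Hₘ = H ∘ (suc m ∷_)

  -- `bump 0` cannot enlarge `[]`, so `tail-✶` is stated for nonempty exponents; a splitting of
  -- `m ∷ α` produces only such.
  F₀✶tailG : Series
  F₀✶tailG []      = 0ℚ
  F₀✶tailG (m ∷ α) = (F₀ ✶ (G ∘ (suc m ∷_))) α

  tail-✶ : ∀ β → length β ≡ suc (length α) → (F ✶ G) (bump 0 β) ≡ F₀✶tailG β + ((F ∘ bump 0) ✶ G) β
  tail-✶ (k ∷ β) _ = ✶-suc∷ F G k β

  middle : (F₀✶tailG ✶ H) (m ∷ α) ≡ (F₀ ✶ (((G ∘ bump 0) ✶ H) ∘ (m ∷_))) α
  middle = begin
    (F₀✶tailG ✶ H) (m ∷ α)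
      ≡⟨ ✶-∷ F₀✶tailG H m α ⟩
    ∑ (upTo (suc m)) (λ i → ((F₀ ✶ (G ∘ (suc i ∷_))) ✶ (H ∘ (m ∸ i ∷_))) α)
      ≡⟨ ∑-cong (upTo (suc m)) (λ i → ✶-assoc F₀ (G ∘ (suc i ∷_)) (H ∘ (m ∸ i ∷_)) α) ⟩
    ∑ (upTo (suc m)) (λ i → (F₀ ✶ ((G ∘ (suc i ∷_)) ✶ (H ∘ (m ∸ i ∷_)))) α)
      ≡⟨ sym (✶-∑ʳ (upTo (suc m)) F₀ (λ i → (G ∘ (suc i ∷_)) ✶ (H ∘ (m ∸ i ∷_))) α) ⟩
    (F₀ ✶ (λ β → ∑ (upTo (suc m)) (λ i → ((G ∘ (suc i ∷_)) ✶ (H ∘ (m ∸ i ∷_))) β))) α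
      ≡⟨ ✶-cong {F = F₀} (λ _ → refl) (λ β → sym (✶-∷ (G ∘ bump 0) H m β)) α ⟩
    (F₀ ✶ (((G ∘ bump 0) ✶ H) ∘ (m ∷_))) α ∎

✶-identityˡ : ∀ F → 𝟙 ✶ F ≐ F
✶-identityˡ F []          = trans (✶-[] 𝟙 F) (ℚ.*-identityˡ (F []))
✶-identityˡ F (zero ∷ α)  = trans (✶-0∷ 𝟙 F α) (✶-identityˡ (F ∘ (0 ∷_)) α)
✶-identityˡ F (suc m ∷ α) = begin
  (𝟙 ✶ F) (suc m ∷ α)
    ≡⟨ ✶-suc∷ 𝟙 F m α ⟩
  (𝟙 ✶ (F ∘ (suc m ∷_))) α + ((𝟙 ∘ bump 0) ✶ F) (m ∷ α)
    ≡⟨ cong₂ _+_ (✶-identityˡ (F ∘ (suc m ∷_)) α)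
         (✶-zero (m ∷ α) 0*) ⟩
  F (suc m ∷ α) + 0ℚ
    ≡⟨ ℚ.+-identityʳ _ ⟩
  F (suc m ∷ α) ∎
  where
  0* : ∀ {β γ} → Split (m ∷ α) β γ → 𝟙 (bump 0 β) * F γ ≡ 0ℚ
  0* {k ∷ β} {γ} _ = ℚ.*-zeroˡ (F γ)

✶-identityʳ : ∀ F → F ✶ 𝟙 ≐ F
✶-identityʳ F α = trans (✶-comm F 𝟙 α) (✶-identityˡ F α)

-- Derivations

D : ℕ → Series → Series
D v F β = ι (at β v) * F β

D-✶ : ∀ v F G → D v (F ✶ G) ≐ (D v F ✶ G) ⊕ (F ✶ D v G)
D-✶ v F G α = begin
  ι (at α v) * (F ✶ G) α
    ≡⟨ cong (ι (at α v) *_) (✶-split F G α) ⟩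
  ι (at α v) * ∑ (splittings α) (λ βγ → F (proj₁ βγ) * G (proj₂ βγ))
    ≡⟨ sym (∑-*ˡ (splittings α) (ι (at α v)) λ βγ → F (proj₁ βγ) * G (proj₂ βγ)) ⟩
  ∑ (splittings α) (λ βγ → ι (at α v) * (F (proj₁ βγ) * G (proj₂ βγ)))
    ≡⟨ ∑-cong-∈ (splittings α) (λ βγ∈ → leibniz (split-∈ α βγ∈)) ⟩
  ∑ (splittings α) (λ βγ → D v F (proj₁ βγ) * G (proj₂ βγ) + F (proj₁ βγ) * D v G (proj₂ βγ))
    ≡⟨ ∑-+ (splittings α) _ _ ⟩
  _
    ≡⟨ cong₂ _+_ (sym (✶-split (D v F) G α)) (sym (✶-split F (D v G) α)) ⟩
  ((D v F ✶ G) ⊕ (F ✶ D v G)) α ∎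
  where
  leibniz : ∀ {β γ} → Split α β γ → ι (at α v) * (F β * G γ) ≡ D v F β * G γ + F β * D v G γ
  leibniz {β} {γ} sp = begin
    ι (at α v) * (F β * G γ)
      ≡⟨ cong (λ k → ι k * (F β * G γ)) (sym (Split.at-split sp v)) ⟩
    ι (at β v ℕ.+ at γ v) * (F β * G γ)
      ≡⟨ cong (_* (F β * G γ)) (ι-+ (at β v) (at γ v)) ⟩
    (ι (at β v) + ι (at γ v)) * (F β * G γ)
      ≡⟨ solve 4 (λ a b x y → ((a :+ b) :* (x :* y)) := ((a :* x) :* y :+ x :* (b :* y))) refl
           (ι (at β v)) (ι (at γ v)) (F β) (G γ) ⟩
    D v F β * G γ + F β * D v G γ ∎

-- If every term of `F` contains y_v, then dividing the product by y_v amounts to dividing `F` by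
-- it.
✶-bump : ∀ v F H → (∀ γ → at γ v ≡ 0 → F γ ≡ 0ℚ) → ∀ β → (F ✶ H) (bump v β) ≡ ((F ∘ bump v) ✶ H) β
✶-bump v       F H F₀ []      = trans (✶-[] F H) (sym (✶-[] (F ∘ bump v) H))
✶-bump zero    F H F₀ (m ∷ β) = begin
  (F ✶ H) (suc m ∷ β)
    ≡⟨ ✶-suc∷ F H m β ⟩
  ((F ∘ (0 ∷_)) ✶ (H ∘ (suc m ∷_))) β + ((F ∘ bump 0) ✶ H) (m ∷ β)
    ≡⟨ cong (_+ ((F ∘ bump 0) ✶ H) (m ∷ β))
         (✶-zero β (λ {γ} {δ} _ → trans (cong (_* H (suc m ∷ δ)) (F₀ (0 ∷ γ) refl)) (ℚ.*-zeroˡ (H (suc m ∷ δ))))) ⟩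
  0ℚ + ((F ∘ bump 0) ✶ H) (m ∷ β)
    ≡⟨ ℚ.+-identityˡ _ ⟩
  ((F ∘ bump 0) ✶ H) (m ∷ β) ∎
✶-bump (suc v) F H F₀ (m ∷ β) = begin
  (F ✶ H) (m ∷ bump v β)
    ≡⟨ ✶-∷ F H m (bump v β) ⟩
  ∑ (upTo (suc m)) (λ i → ((F ∘ (i ∷_)) ✶ (H ∘ (m ∸ i ∷_))) (bump v β))
    ≡⟨ ∑-cong (upTo (suc m)) (λ i → ✶-bump v (F ∘ (i ∷_)) (H ∘ (m ∸ i ∷_)) (λ γ → F₀ (i ∷ γ)) β) ⟩
  ∑ (upTo (suc m)) (λ i → ((F ∘ bump (suc v) ∘ (i ∷_)) ✶ (H ∘ (m ∸ i ∷_))) β)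
    ≡⟨ sym (✶-∷ (F ∘ bump (suc v)) H m β) ⟩
  ((F ∘ bump (suc v)) ✶ H) (m ∷ β) ∎

-- Exponents

All-0⇒sum≡0 : ∀ {α} → All (_≡ 0) α → sum α ≡ 0
All-0⇒sum≡0 []         = refl
All-0⇒sum≡0 (refl ∷ z) = All-0⇒sum≡0 z

sum≡0⇒All-0 : ∀ α → sum α ≡ 0 → All (_≡ 0) α
sum≡0⇒All-0 []         _  = []
sum≡0⇒All-0 (zero ∷ α) eq = refl ∷ sum≡0⇒All-0 α eq

at≤sum : ∀ α i → at α i ℕ.≤ sum α
at≤sum []      i       = z≤n
at≤sum (m ∷ α) zero    = ℕ.m≤m+n m (sum α)
at≤sum (m ∷ α) (suc i) = ℕ.≤-trans (at≤sum α i) (ℕ.m≤n+m (sum α) m)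

at-bump : ∀ v α → v ℕ.< length α → at (bump v α) v ≡ suc (at α v)
at-bump zero    (m ∷ α) _        = refl
at-bump (suc v) (m ∷ α) (s≤s v<) = at-bump v α v<

at-bump-≢ : ∀ {v w} α → w ≢ v → at (bump v α) w ≡ at α w
at-bump-≢ []                      w≢v = refl
at-bump-≢ {zero}  {zero}  (m ∷ α) w≢v = ⊥-elim (w≢v refl)
at-bump-≢ {zero}  {suc w} (m ∷ α) w≢v = refl
at-bump-≢ {suc v} {zero}  (m ∷ α) w≢v = refl
at-bump-≢ {suc v} {suc w} (m ∷ α) w≢v = at-bump-≢ α (w≢v ∘ cong suc)

length-bump : ∀ v α → length (bump v α) ≡ length α
length-bump v       []      = refl
length-bump zero    (m ∷ α) = refl
length-bump (suc v) (m ∷ α) = cong suc (length-bump v α)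

sum-bump : ∀ v α → v ℕ.< length α → sum (bump v α) ≡ suc (sum α)
sum-bump zero    (m ∷ α) _        = refl
sum-bump (suc v) (m ∷ α) (s≤s v<) = trans (cong (m ℕ.+_) (sum-bump v α v<)) (ℕ.+-suc m (sum α))

unbump : ∀ v α → 1 ℕ.≤ at α v → ∃ λ β → α ≡ bump v β
unbump zero    (suc m ∷ α) _  = (m ∷ α) , refl
unbump (suc v) (m ∷ α)     1≤ with unbump v α 1≤
... | β , refl = (m ∷ β) , refl

at<length : ∀ v α → 1 ℕ.≤ at α v → v ℕ.< length α
at<length zero    (m ∷ α) _  = s≤s z≤n
at<length (suc v) (m ∷ α) 1≤ = s≤s (at<length v α 1≤)

𝟙-true : ∀ α → sum α ≡ 0 → 𝟙 α ≡ 1ℚ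
𝟙-true α eq = indicator-true (all? (ℕ._≟ 0) α) (sum≡0⇒All-0 α eq)

𝟙-false : ∀ α → 1 ℕ.≤ sum α → 𝟙 α ≡ 0ℚ
𝟙-false α 1≤ = indicator-false (all? (ℕ._≟ 0) α) (λ z → ℕ.<⇒≢ 1≤ (sym (All-0⇒sum≡0 z)))

-- Logarithmic derivatives

-- The partial sum 1 + U + ⋯ + U^N of 1/(1 - U), in Horner form.
geometric : Series → ℕ → Series
geometric U zero    = 𝟙
geometric U (suc N) = 𝟙 ⊕ (U ✶ geometric U N)

module Inverse (S : Series) (S₀ : ∀ α → sum α ≡ 0 → S α ≡ 1ℚ) where

  U : Series
  U = 𝟙 ⊖ S

  U₀ : ∀ α → sum α ≡ 0 → U α ≡ 0ℚ
  U₀ α eq = trans (cong₂ _-_ (𝟙-true α eq) (S₀ α eq)) (ℚ.+-inverseʳ 1ℚ)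

  -- Since U has no constant term, U^k contributes only in degrees at least k; at `α` the partial
  -- sums are constant from N = `sum α` on.
  inverse : Series
  inverse α = geometric U (sum α) α

  -- U has no constant term, so U ✶ F only involves the terms of F of smaller degree.
  U✶-cong : ∀ {F F′} α → (∀ γ → sum γ ℕ.< sum α → F γ ≡ F′ γ) → (U ✶ F) α ≡ (U ✶ F′) α
  U✶-cong {F} {F′} α eq = ✶-cong-∈ α λ {β} {γ} sp → term β γ (Split.sum-split sp)
    where
    term : ∀ β γ → sum β ℕ.+ sum γ ≡ sum α → U β * F γ ≡ U β * F′ γ
    term β γ sp with sum β in β₀
    ... | zero  = trans (trans (cong (_* F γ) (U₀ β β₀)) (ℚ.*-zeroˡ (F γ)))
                    (sym (trans (cong (_* F′ γ) (U₀ β β₀)) (ℚ.*-zeroˡ (F′ γ))))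
    ... | suc k = cong (U β *_) (eq γ (subst (sum γ ℕ.<_) sp (s≤s (ℕ.m≤n+m (sum γ) k))))

  geometric-step : ∀ N α → sum α ℕ.≤ N → geometric U (suc N) α ≡ geometric U N α
  geometric-step zero    α ≤0 = trans (cong (𝟙 α +_) (trans (✶-identityʳ U α) (U₀ α (ℕ.n≤0⇒n≡0 ≤0)))) (ℚ.+-identityʳ _)
  geometric-step (suc N) α ≤N = cong (𝟙 α +_)
    (U✶-cong α (λ γ γ< → geometric-step N γ (s≤s⁻¹ (ℕ.≤-trans γ< ≤N))))

  geometric-inverse : ∀ N α → sum α ℕ.≤ N → geometric U N α ≡ inverse α
  geometric-inverse N α ≤N = go N (ℕ.≤⇒≤′ ≤N)
    where
    go : ∀ N → sum α ℕ.≤′ N → geometric U N α ≡ inverse α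
    go N       ℕ.≤′-refl      = refl
    go (suc N) (ℕ.≤′-step ≤N) = trans (geometric-step N α (ℕ.≤′⇒≤ ≤N)) (go N ≤N)

  inverse-fixed : inverse ≐ 𝟙 ⊕ (U ✶ inverse)
  inverse-fixed α = trans (sym (geometric-step (sum α) α ℕ.≤-refl))
    (cong (𝟙 α +_) (U✶-cong α (λ γ γ< → geometric-inverse (sum α) γ (ℕ.<⇒≤ γ<))))

  ✶-inverse : S ✶ inverse ≐ 𝟙
  ✶-inverse α = begin
    (S ✶ inverse) α
      ≡⟨ solve 3 (λ s u o → s := ((s :+ u) :+ (:- (o :+ u)) :+ o)) refl
           ((S ✶ inverse) α) ((U ✶ inverse) α) (𝟙 α) ⟩
    ((S ✶ inverse) α + (U ✶ inverse) α) - (𝟙 α + (U ✶ inverse) α) + 𝟙 α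
      ≡⟨ cong₂ (λ x y → x - y + 𝟙 α) S+U (sym (inverse-fixed α)) ⟩
    inverse α - inverse α + 𝟙 α
      ≡⟨ cong (_+ 𝟙 α) (ℚ.+-inverseʳ (inverse α)) ⟩
    0ℚ + 𝟙 α
      ≡⟨ ℚ.+-identityˡ (𝟙 α) ⟩
    𝟙 α ∎
    where
    S+U : (S ✶ inverse) α + (U ✶ inverse) α ≡ inverse α
    S+U = begin
      (S ✶ inverse) α + (U ✶ inverse) α
        ≡⟨ sym (✶-distribʳ S U inverse α) ⟩
      ((S ⊕ U) ✶ inverse) α
        ≡⟨ ✶-cong {G = inverse} (λ β → solve 2 (λ s o → (s :+ (o :+ (:- s))) := o) refl (S β) (𝟙 β)) (λ _ → refl) α ⟩
      (𝟙 ✶ inverse) α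
        ≡⟨ ✶-identityˡ inverse α ⟩
      inverse α ∎

  negD : ℕ → Series
  negD v α = - D v S α

  -- For the S of a graph, the coefficient of y^U counts the acyclic orientations of
  -- the subgraph induced on U whose only sink is v.
  p : ℕ → Series
  p v = negD v ✶ inverse

  negD-support : ∀ v γ → at γ v ≡ 0 → negD v γ ≡ 0ℚ
  negD-support v γ eq = trans (cong (λ k → - (ι k * S γ)) eq) (cong -_ (ℚ.*-zeroˡ (S γ)))

  p-support : ∀ v β → at β v ≡ 0 → p v β ≡ 0ℚ
  p-support v β eq = ✶-zero β λ {γ} {δ} sp → trans
    (cong (_* inverse δ) (negD-support v γ (ℕ.m+n≡0⇒m≡0 (at γ v) (trans (Split.at-split sp v) eq))))
    (ℚ.*-zeroˡ (inverse δ))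

  -- Differentiating S · S⁻¹ = 1 gives S · D_w(S⁻¹) = - (D_w S) · S⁻¹.
  S✶Dinverse : ∀ w → S ✶ D w inverse ≐ p w
  S✶Dinverse w α = begin
    y
      ≡⟨ solve 3 (λ x y z → y := ((x :+ y) :+ (:- (z :+ x)) :+ z)) refl x y z ⟩
    (x + y) - (z + x) + z
      ≡⟨ cong₂ (λ a b → a - b + z) x+y z+x ⟩
    0ℚ - 0ℚ + z
      ≡⟨ ℚ.+-identityˡ z ⟩
    z ∎
    where
    x = (D w S ✶ inverse) α
    y = (S ✶ D w inverse) α
    z = p w α
    D𝟙 : D w 𝟙 α ≡ 0ℚ
    D𝟙 with at α w in eq
    ... | zero  = ℚ.*-zeroˡ (𝟙 α)
    ... | suc k = trans (cong (ι (suc k) *_)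
                    (𝟙-false α (ℕ.≤-trans (s≤s z≤n) (subst (ℕ._≤ sum α) eq (at≤sum α w))))) (ℚ.*-zeroʳ (ι (suc k)))
    x+y : x + y ≡ 0ℚ
    x+y = trans (sym (D-✶ w S inverse α)) (trans (cong (ι (at α w) *_) (✶-inverse α)) D𝟙)
    z+x : z + x ≡ 0ℚ
    z+x = trans (sym (✶-distribʳ (negD w) (D w S) inverse α))
      (✶-zero α λ {β} {γ} _ → trans (cong (_* inverse γ) (ℚ.+-inverseˡ (D w S β))) (ℚ.*-zeroˡ (inverse γ)))

  D-inverse : ∀ w → D w inverse ≐ inverse ✶ p w
  D-inverse w α = begin
    D w inverse α                            ≡⟨ sym (✶-identityˡ (D w inverse) α) ⟩
    (𝟙 ✶ D w inverse) α                      ≡⟨ ✶-cong {G = D w inverse} (sym ∘ ✶-inverse) (λ _ → refl) α ⟩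
    ((S ✶ inverse) ✶ D w inverse) α          ≡⟨ ✶-cong {G = D w inverse} (✶-comm S inverse) (λ _ → refl) α ⟩
    ((inverse ✶ S) ✶ D w inverse) α          ≡⟨ ✶-assoc inverse S (D w inverse) α ⟩
    (inverse ✶ (S ✶ D w inverse)) α          ≡⟨ ✶-cong {F = inverse} (λ _ → refl) (S✶Dinverse w) α ⟩
    (inverse ✶ p w) α                        ∎

  D-p : ∀ w v → D w (p v) ≐ (D w (negD v) ✶ inverse) ⊕ (p v ✶ p w)
  D-p w v α = trans (D-✶ w (negD v) inverse α) (cong ((D w (negD v) ✶ inverse) α +_)
    (trans (✶-cong {F = negD v} (λ _ → refl) (D-inverse w) α) (sym (✶-assoc (negD v) inverse (p w) α))))

  -- As p_v = - D_v log S, both sides are coefficients of - D_v D_w log S, and the two operators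
  -- commute.
  p-symmetric : ∀ v w α → ι (at α w) * p v α ≡ ι (at α v) * p w α
  p-symmetric v w α = begin
    D w (p v) α
      ≡⟨ D-p w v α ⟩
    (D w (negD v) ✶ inverse) α + (p v ✶ p w) α
      ≡⟨ cong₂ _+_ (✶-cong {G = inverse} DD (λ _ → refl) α) (✶-comm (p v) (p w) α) ⟩
    (D v (negD w) ✶ inverse) α + (p w ✶ p v) α
      ≡⟨ sym (D-p v w α) ⟩
    D v (p w) α ∎
    where
    DD : D w (negD v) ≐ D v (negD w)
    DD β = solve 3 (λ a b s → (a :* (:- (b :* s))) := (b :* (:- (a :* s)))) refl (ι (at β w)) (ι (at β v)) (S β)

  -- By hypothesis D w (D v S) = 0.
  p-edge : ∀ v w → (∀ β → 1 ℕ.≤ at β v → 1 ℕ.≤ at β w → S β ≡ 0ℚ) →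
           ∀ α → ι (at α w) * p v α ≡ (p v ✶ p w) α
  p-edge v w S≡0 α = trans (D-p w v α) (trans
    (cong (_+ (p v ✶ p w) α) (✶-zero α λ {β} {γ} _ → trans (cong (_* inverse γ) (DD β)) (ℚ.*-zeroˡ (inverse γ))))
    (ℚ.+-identityˡ _))
    where
    DD : ∀ β → D w (negD v) β ≡ 0ℚ
    DD β with at β v in βᵥ | at β w in β𝓌
    ... | k     | zero  = ℚ.*-zeroˡ (- (ι k * S β))
    ... | zero  | suc l = trans (cong (λ q → ι (suc l) * - q) (ℚ.*-zeroˡ (S β))) (ℚ.*-zeroʳ (ι (suc l)))
    ... | suc k | suc l = trans
      (cong (λ s → ι (suc l) * - (ι (suc k) * s)) (S≡0 β (subst (1 ℕ.≤_) (sym βᵥ) (s≤s z≤n)) (subst (1 ℕ.≤_) (sym β𝓌) (s≤s z≤n))))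
      (trans (cong (λ q → ι (suc l) * - q) (ℚ.*-zeroʳ (ι (suc k)))) (ℚ.*-zeroʳ (ι (suc l))))

  -- The hypothesis is the shape of S = (1 - y_v) S′ with S′ free of y_v: then - D_v S = y_v S′, and
  -- dividing by y_v leaves S′ = S + y_v S′. Dividing by S gives p_v / y_v = 1 + p_v. It is asked
  -- only below `β`, because the factorisation will hold only on some monomials.
  p-bump : ∀ v β → (∀ γ δ → Split β γ δ → negD v (bump v γ) ≡ S γ + negD v γ) →
           p v (bump v β) ≡ 𝟙 β + p v β
  p-bump v β eq = begin
    (negD v ✶ inverse) (bump v β)
      ≡⟨ ✶-bump v (negD v) inverse (negD-support v) β ⟩
    ((negD v ∘ bump v) ✶ inverse) β
      ≡⟨ ✶-cong-∈ β (λ {γ} {δ} sp → cong (_* inverse δ) (eq γ δ sp)) ⟩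
    ((S ⊕ negD v) ✶ inverse) β
      ≡⟨ ✶-distribʳ S (negD v) inverse β ⟩
    (S ✶ inverse) β + p v β
      ≡⟨ cong (_+ p v β) (✶-inverse β) ⟩
    𝟙 β + p v β ∎

-- Splittings under changes of a single exponent

split-comm : ∀ {α β γ} → Split α β γ → Split α γ β
split-comm {α} {β} {γ} (split at-s sum-s lˡ lʳ) = split
  (λ i → trans (ℕ.+-comm (at γ i) (at β i)) (at-s i)) (trans (ℕ.+-comm (sum γ) (sum β)) sum-s) lʳ lˡ

split-bumpˡ : ∀ v {α β γ} → v ℕ.< length α → Split α β γ → Split (bump v α) (bump v β) γ
split-bumpˡ v {α} {β} {γ} v< (split at-s sum-s lˡ lʳ) = split at-b
  (trans (cong (ℕ._+ sum γ) (sum-bump v β v<β)) (trans (cong suc sum-s) (sym (sum-bump v α v<))))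
  (trans (length-bump v β) (trans lˡ (sym (length-bump v α)))) (trans lʳ (sym (length-bump v α)))
  where
  v<β = subst (v ℕ.<_) (sym lˡ) v<
  at-b : ∀ i → at (bump v β) i ℕ.+ at γ i ≡ at (bump v α) i
  at-b i with i ℕ.≟ v
  ... | yes refl = trans (cong (ℕ._+ at γ i) (at-bump i β v<β)) (trans (cong suc (at-s i)) (sym (at-bump i α v<)))
  ... | no i≢v   = trans (cong (ℕ._+ at γ i) (at-bump-≢ β i≢v)) (trans (at-s i) (sym (at-bump-≢ α i≢v)))

split-bumpʳ : ∀ v {α β γ} → v ℕ.< length α → Split α β γ → Split (bump v α) β (bump v γ)
split-bumpʳ v v< = split-comm ∘ split-bumpˡ v v< ∘ split-comm

split-≤ˡ : ∀ {α β γ B} → Split α β γ → sum α ℕ.≤ B → sum β ℕ.≤ B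
split-≤ˡ {β = β} {γ} sp ≤B = ℕ.≤-trans (ℕ.≤-trans (ℕ.m≤m+n (sum β) (sum γ)) (ℕ.≤-reflexive (Split.sum-split sp))) ≤B

split-≤ʳ : ∀ {α β γ B} → Split α β γ → sum α ℕ.≤ B → sum γ ℕ.≤ B
split-≤ʳ = split-≤ˡ ∘ split-comm

∈-splittings : ∀ α {β γ} → Split α β γ → (β , γ) ∈ splittings α
∈-splittings []      {[]}    {[]}    _  = here refl
∈-splittings (m ∷ α) {i ∷ β} {j ∷ γ} (split at-s sum-s lˡ lʳ) =
  subst (λ k → (i ∷ β , k ∷ γ) ∈ splittings (m ∷ α)) m∸i≡j
    (∈-cartesianProductWith⁺ _ (∈-upTo⁺ (s≤s (subst (i ℕ.≤_) (at-s 0) (ℕ.m≤m+n i j)))) (∈-splittings α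
      (split (at-s ∘ suc) (ℕ.+-cancelˡ-≡ m _ _ sum′) (ℕ.suc-injective lˡ) (ℕ.suc-injective lʳ))))
  where
  m∸i≡j : m ∸ i ≡ j
  m∸i≡j = trans (cong (_∸ i) (sym (at-s 0))) (ℕ.m+n∸m≡n i j)
  sum′ : m ℕ.+ (sum β ℕ.+ sum γ) ≡ m ℕ.+ sum α
  sum′ = trans (cong (ℕ._+ (sum β ℕ.+ sum γ)) (sym (at-s 0)))
    (trans (ℕ+.interchange i j (sum β) (sum γ)) sum-s)

zeros : ℕ → List ℕ
zeros n = replicate n 0

ones : ℕ → List ℕ
ones n = replicate n 1

at-zeros : ∀ n i → at (zeros n) i ≡ 0
at-zeros zero    i       = refl
at-zeros (suc n) zero    = refl
at-zeros (suc n) (suc i) = at-zeros n i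

sum-zeros : ∀ n → sum (zeros n) ≡ 0
sum-zeros zero    = refl
sum-zeros (suc n) = sum-zeros n

zeros≤1 : ∀ k → All (ℕ._≤ 1) (zeros k)
zeros≤1 zero    = []
zeros≤1 (suc k) = z≤n ∷ zeros≤1 k

sum-ones : ∀ k → sum (ones k) ≡ k
sum-ones zero    = refl
sum-ones (suc k) = cong suc (sum-ones k)

ones≤1 : ∀ k → All (ℕ._≤ 1) (ones k)
ones≤1 zero    = []
ones≤1 (suc k) = ℕ.≤-refl ∷ ones≤1 k

at-ones : ∀ {k i} → i ℕ.< k → at (ones k) i ≡ 1
at-ones {suc k} {zero}  _        = refl
at-ones {suc k} {suc i} (s≤s i<) = at-ones i<

split-zerosʳ : ∀ α → Split α α (zeros (length α))
split-zerosʳ α = split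
  (λ i → trans (cong (at α i ℕ.+_) (at-zeros (length α) i)) (ℕ.+-identityʳ _))
  (trans (cong (sum α ℕ.+_) (sum-zeros (length α))) (ℕ.+-identityʳ _)) refl (length-replicate (length α))

at-≤1 : ∀ {α} → All (ℕ._≤ 1) α → ∀ i → at α i ℕ.≤ 1
at-≤1 []        i       = z≤n
at-≤1 (m≤1 ∷ _) zero    = m≤1
at-≤1 (_ ∷ α≤1) (suc i) = at-≤1 α≤1 i

bump-≤1 : ∀ v {α} → at α v ≡ 0 → All (ℕ._≤ 1) α → All (ℕ._≤ 1) (bump v α)
bump-≤1 v       _  []        = []
bump-≤1 zero    eq (_ ∷ α≤1) = subst (λ m → suc m ℕ.≤ 1) (sym eq) ℕ.≤-refl ∷ α≤1
bump-≤1 (suc v) eq (m≤1 ∷ α≤1) = m≤1 ∷ bump-≤1 v eq α≤1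

bump-≤1⁻ : ∀ v α → All (ℕ._≤ 1) (bump v α) → All (ℕ._≤ 1) α
bump-≤1⁻ v       []      _           = []
bump-≤1⁻ zero    (m ∷ α) (m<1 ∷ α≤1) = ℕ.<⇒≤ m<1 ∷ α≤1
bump-≤1⁻ (suc v) (m ∷ α) (m≤1 ∷ α≤1) = m≤1 ∷ bump-≤1⁻ v α α≤1

at≤at-bump : ∀ {v} α i → v ℕ.< length α → at α i ℕ.≤ at (bump v α) i
at≤at-bump {v} α i v< with i ℕ.≟ v
... | yes refl = subst (at α i ℕ.≤_) (sym (at-bump i α v<)) (ℕ.n≤1+n (at α i))
... | no i≢v   = ℕ.≤-reflexive (sym (at-bump-≢ α i≢v))

sum≤length : ∀ {α} → All (ℕ._≤ 1) α → sum α ℕ.≤ length α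
sum≤length []          = z≤n
sum≤length (m≤1 ∷ α≤1) = ℕ.+-mono-≤ m≤1 (sum≤length α≤1)

sum<length : ∀ {α} v → v ℕ.< length α → All (ℕ._≤ 1) α → at α v ≡ 0 → sum α ℕ.< length α
sum<length {0 ∷ α} zero    _        (_ ∷ α≤1)   _  = s≤s (sum≤length α≤1)
sum<length {m ∷ α} (suc v) (s≤s v<) (m≤1 ∷ α≤1) eq = ℕ.+-mono-≤-< m≤1 (sum<length v v< α≤1 eq)

≡ones : ∀ {α} → All (ℕ._≤ 1) α → (∀ i → i ℕ.< length α → 1 ℕ.≤ at α i) → α ≡ ones (length α)
≡ones []          _  = refl
≡ones (m≤1 ∷ α≤1) ≥1 = cong₂ _∷_ (ℕ.≤-antisym m≤1 (≥1 0 (s≤s z≤n))) (≡ones α≤1 (λ i i< → ≥1 (suc i) (s≤s i<)))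

-- The alternating stable-set series of a graph

sgn : ℕ → ℚ
sgn zero    = 1ℚ
sgn (suc n) = - sgn n

module OnGraph {n : ℕ} (G : Graph n) where
  open Graph G

  Stable : List ℕ → Set
  Stable β = All (ℕ._≤ 1) β × (∀ u v → Adj u v → ¬ (1 ℕ.≤ at β (toℕ u) × 1 ℕ.≤ at β (toℕ v)))

  stable? : ∀ β → Dec (Stable β)
  stable? β = all? (ℕ._≤? 1) β ×-dec Fin.all? λ u → Fin.all? λ v →
              adj? u v →-dec ¬? ((1 ℕ.≤? at β (toℕ u)) ×-dec (1 ℕ.≤? at β (toℕ v)))

  stable₀ : ∀ {β} → sum β ≡ 0 → Stable β
  stable₀ {β} eq = All.map (λ { refl → z≤n }) (sum≡0⇒All-0 β eq) ,
    λ u v _ (1≤ , _) → ℕ.1+n≰n (ℕ.≤-trans 1≤ (subst (at β (toℕ u) ℕ.≤_) eq (at≤sum β (toℕ u))))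

  S : Series
  S β = sgn (sum β) * indicator (stable? β)

  S₀ : ∀ β → sum β ≡ 0 → S β ≡ 1ℚ
  S₀ β eq = trans (cong₂ _*_ (cong sgn eq) (indicator-true (stable? β) (stable₀ eq))) (ℚ.*-identityˡ 1ℚ)

  open Inverse S S₀ public

  S-unstable : ∀ β → ¬ Stable β → S β ≡ 0ℚ
  S-unstable β ¬st = trans (cong (sgn (sum β) *_) (indicator-false (stable? β) ¬st)) (ℚ.*-zeroʳ (sgn (sum β)))

  Isolated : Fin n → List ℕ → Set
  Isolated v β = ∀ w → Adj v w → at β (toℕ w) ≡ 0

  -- On monomials without a neighbour of v, adding v to a set does not affect its stability, so S
  -- behaves as (1 - y_v) S′ and `p-bump` applies.
  p-bump-isolated : ∀ {v β} → toℕ v ℕ.< length β → Isolated v β →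
                    p (toℕ v) (bump (toℕ v) β) ≡ 𝟙 β + p (toℕ v) β
  p-bump-isolated {v} {β} v< isolated = p-bump (toℕ v) β step
    where
    i = toℕ v
    step : ∀ γ δ → Split β γ δ → negD i (bump i γ) ≡ S γ + negD i γ
    step γ δ sp = trans
      (cong₂ (λ k l → - (ι k * (sgn l * indicator (stable? (bump i γ))))) (at-bump i γ v<γ) (sum-bump i γ v<γ))
      cases
      where
      v<γ = subst (i ℕ.<_) (sym (Split.lengthˡ sp)) v<

      isolatedγ : Isolated v γ
      isolatedγ w v~w = ℕ.m+n≡0⇒m≡0 (at γ (toℕ w)) (trans (Split.at-split sp (toℕ w)) (isolated w v~w))

      stable-bump : at γ i ≡ 0 → Stable γ → Stable (bump i γ)
      stable-bump eq (γ≤1 , indep) = bump-≤1 i eq γ≤1 , indep′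
        where
        indep′ : ∀ u w → Adj u w → ¬ (1 ℕ.≤ at (bump i γ) (toℕ u) × 1 ℕ.≤ at (bump i γ) (toℕ w))
        indep′ u w u~w (1≤u , 1≤w) with u Fin.≟ v | w Fin.≟ v
        ... | yes refl | yes refl = irrefl refl u~w
        ... | yes refl | no w≢v   = ℕ.1+n≰n (subst (1 ℕ.≤_) (trans (at-bump-≢ γ (w≢v ∘ Fin.toℕ-injective)) (isolatedγ w u~w)) 1≤w)
        ... | no u≢v   | yes refl = ℕ.1+n≰n (subst (1 ℕ.≤_) (trans (at-bump-≢ γ (u≢v ∘ Fin.toℕ-injective)) (isolatedγ u (symm u~w))) 1≤u)
        ... | no u≢v   | no w≢v   = indep u w u~w
          ( subst (1 ℕ.≤_) (at-bump-≢ γ (u≢v ∘ Fin.toℕ-injective)) 1≤u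
          , subst (1 ℕ.≤_) (at-bump-≢ γ (w≢v ∘ Fin.toℕ-injective)) 1≤w)

      stable-unbump : Stable (bump i γ) → Stable γ
      stable-unbump (γ≤1 , indep) = bump-≤1⁻ i γ γ≤1 ,
        λ u w u~w (1≤u , 1≤w) → indep u w u~w (ℕ.≤-trans 1≤u (at≤at-bump γ (toℕ u) v<γ) , ℕ.≤-trans 1≤w (at≤at-bump γ (toℕ w) v<γ))

      cases : - (ι (suc (at γ i)) * (sgn (suc (sum γ)) * indicator (stable? (bump i γ)))) ≡ S γ + negD i γ
      -- For exponent 0 the added vertex keeps `γ` stable or unstable and flips the sign. For
      -- exponent 1 the left side is unstable and the two terms on the right cancel. From exponent 2
      -- on everything is unstable.
      cases with at γ i in γᵢ
      ... | zero = trans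
        (cong (λ s → - (ι 1 * (sgn (suc (sum γ)) * s))) (indicator-⇔ (stable? (bump i γ)) (stable? γ) stable-unbump (stable-bump γᵢ)))
        (solve 2 (λ x s → (:- ((con 1ℚ :+ con 0ℚ) :* ((:- x) :* s))) := (x :* s :+ (:- (con 0ℚ :* (x :* s))))) refl
          (sgn (sum γ)) (indicator (stable? γ)))
      ... | suc zero = trans
        (cong (λ s → - (ι 2 * (sgn (suc (sum γ)) * s))) (indicator-false (stable? (bump i γ)) unstable))
        (solve 2 (λ x s → (:- ((con 1ℚ :+ (con 1ℚ :+ con 0ℚ)) :* ((:- x) :* con 0ℚ))) := (x :* s :+ (:- ((con 1ℚ :+ con 0ℚ) :* (x :* s))))) refl
          (sgn (sum γ)) (indicator (stable? γ)))
        where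
        unstable : ¬ Stable (bump i γ)
        unstable (γ≤1 , _) = ℕ.1+n≰n (subst (ℕ._≤ 1) (trans (at-bump i γ v<γ) (cong suc γᵢ)) (at-≤1 γ≤1 i))
      ... | suc (suc k) = trans
        (cong (λ s → - (ι (3 ℕ.+ k) * (sgn (suc (sum γ)) * s))) (indicator-false (stable? (bump i γ)) (unstable ∘ stable-unbump)))
        (trans
          (solve 2 (λ a x → (:- (a :* (x :* con 0ℚ))) := (x :* con 0ℚ :+ (:- (a :* (x :* con 0ℚ))))) refl (ι (3 ℕ.+ k)) (sgn (suc (sum γ))))
          (trans (solve 3 (λ a b x → ((:- x) :* con 0ℚ :+ (:- (a :* ((:- x) :* con 0ℚ)))) := (x :* con 0ℚ :+ (:- (b :* (x :* con 0ℚ))))) refl (ι (3 ℕ.+ k)) (ι (2 ℕ.+ k)) (sgn (sum γ)))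
            (cong (λ s → sgn (sum γ) * s + - (ι (2 ℕ.+ k) * (sgn (sum γ) * s))) (sym (indicator-false (stable? γ) unstable)))))
        where
        unstable : ¬ Stable γ
        unstable (γ≤1 , _) = ℕ.1+n≰n (ℕ.≤-trans (s≤s (s≤s z≤n)) (subst (ℕ._≤ 1) γᵢ (at-≤1 γ≤1 i)))

  S-edge : ∀ {v w} → Adj v w → ∀ β → 1 ℕ.≤ at β (toℕ v) → 1 ℕ.≤ at β (toℕ w) → S β ≡ 0ℚ
  S-edge {v} {w} v~w β 1≤v 1≤w = S-unstable β (λ (_ , indep) → indep v w v~w (1≤v , 1≤w))

  unbump-isolated : ∀ {v w} α → Isolated v (bump w α) → Isolated v α
  unbump-isolated {w = w} α isolated u v~u with toℕ u ℕ.≟ w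
  ... | yes refl = ℕ.n≤0⇒n≡0 (ℕ.≮⇒≥ λ 1≤ → ℕ.1+n≢0 (trans (sym (at-bump w α (at<length w α 1≤))) (isolated u v~u)))
  ... | no u≢w   = trans (sym (at-bump-≢ α u≢w)) (isolated u v~u)

  -- Induction on the degree. If v has a neighbour w in the support, `p-edge` expresses a positive
  -- multiple of the coefficient through products of coefficients of p_v and p_w; otherwise
  -- `p-bump-isolated` lowers the exponent of v.
  p-nonneg : ∀ β → length β ≡ n → ∀ v → 0ℚ ≤ p (toℕ v) β
  p-nonneg β len = go (sum β) β ℕ.≤-refl len
    where
    go : ∀ N β → sum β ℕ.≤ N → length β ≡ n → ∀ v → 0ℚ ≤ p (toℕ v) β
    go N β ≤N len v with 1 ℕ.≤? at β (toℕ v)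
    ... | no 1≰ = subst (0ℚ ≤_) (sym (p-support (toℕ v) β (ℕ.n<1⇒n≡0 (ℕ.≰⇒> 1≰)))) ℚ.≤-refl
    go zero    β ≤N len v | yes 1≤ = ⊥-elim (ℕ.1+n≰n (ℕ.≤-trans 1≤ (ℕ.≤-trans (at≤sum β (toℕ v)) ≤N)))
    go (suc N) β ≤N len v | yes 1≤ with Fin.any? (λ w → adj? v w ×-dec (1 ℕ.≤? at β (toℕ w)))
    ... | yes (w , v~w , 1≤w) = *-cancel-nonneg (ι-pos 1≤w)
      (subst (0ℚ ≤_) (sym (p-edge (toℕ v) (toℕ w) (S-edge v~w) β)) (✶-nonneg β term))
      where
      -- Each p vanishes on monomials without its own vertex. In the remaining splittings both parts
      -- are nonempty, hence of smaller degree than `β`.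
      term : ∀ {γ δ} → Split β γ δ → 0ℚ ≤ p (toℕ v) γ * p (toℕ w) δ
      term {γ} {δ} sp with 1 ℕ.≤? at γ (toℕ v) | 1 ℕ.≤? at δ (toℕ w)
      ... | no 1≰ | _ = subst (0ℚ ≤_) (sym (trans (cong (_* p (toℕ w) δ) (p-support (toℕ v) γ (ℕ.n<1⇒n≡0 (ℕ.≰⇒> 1≰)))) (ℚ.*-zeroˡ (p (toℕ w) δ)))) ℚ.≤-refl
      ... | yes _ | no 1≰ = subst (0ℚ ≤_) (sym (trans (cong (p (toℕ v) γ *_) (p-support (toℕ w) δ (ℕ.n<1⇒n≡0 (ℕ.≰⇒> 1≰)))) (ℚ.*-zeroʳ (p (toℕ v) γ)))) ℚ.≤-refl
      ... | yes 1≤γ | yes 1≤δ = *-nonneg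
        (go N γ (s≤s⁻¹ (ℕ.≤-trans sumγ< ≤N)) (trans (Split.lengthˡ sp) len) v)
        (go N δ (s≤s⁻¹ (ℕ.≤-trans sumδ< ≤N)) (trans (Split.lengthʳ sp) len) w)
        where
        sumγ< : sum γ ℕ.< sum β
        sumγ< = subst (sum γ ℕ.<_) (Split.sum-split sp) (ℕ.m<m+n (sum γ) (ℕ.≤-trans 1≤δ (at≤sum δ (toℕ w))))
        sumδ< : sum δ ℕ.< sum β
        sumδ< = subst (sum δ ℕ.<_) (Split.sum-split sp) (ℕ.m<n+m (sum δ) (ℕ.≤-trans 1≤γ (at≤sum γ (toℕ v))))
    ... | no ¬nbr with unbump (toℕ v) β 1≤
    ... | β′ , refl = subst (0ℚ ≤_) (sym (p-bump-isolated {v} v<β′ (unbump-isolated {v} β′ isolated)))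
      (+-nonneg (indicator-nonneg (all? (ℕ._≟ 0) β′)) (go N β′ (s≤s⁻¹ (subst (ℕ._≤ suc N) (sum-bump (toℕ v) β′ v<β′) ≤N)) len′ v))
      where
      len′ = trans (sym (length-bump (toℕ v) β′)) len
      v<β′ : toℕ v ℕ.< length β′
      v<β′ = subst (toℕ v ℕ.<_) (sym len′) (Fin.toℕ<n v)
      isolated : Isolated v β
      isolated w v~w = ℕ.n<1⇒n≡0 (ℕ.≰⇒> (λ 1≤w → ¬nbr (w , v~w , 1≤w)))

  -- Here p_v agrees with y_v / (1 - y_v), which has no term involving another variable. The
  -- induction strips the powers of y_v until `p-support` applies.
  p-isolated : ∀ {v w β} → w ≢ toℕ v → 1 ℕ.≤ at β w → Isolated v β → p (toℕ v) β ≡ 0ℚ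
  p-isolated {v} {w} {β} w≢v 1≤w isolated = go (at β (toℕ v)) β refl 1≤w isolated
    where
    go : ∀ k β → at β (toℕ v) ≡ k → 1 ℕ.≤ at β w → Isolated v β → p (toℕ v) β ≡ 0ℚ
    go zero    β eq _   _ = p-support (toℕ v) β eq
    go (suc k) β eq 1≤w isolated with unbump (toℕ v) β (subst (1 ℕ.≤_) (sym eq) (s≤s z≤n))
    ... | β′ , refl = begin
      p (toℕ v) (bump (toℕ v) β′)  ≡⟨ p-bump-isolated {v} v<β′ isolated′ ⟩
      𝟙 β′ + p (toℕ v) β′          ≡⟨ cong₂ _+_ (𝟙-false β′ (ℕ.≤-trans 1≤w′ (at≤sum β′ w))) (go k β′ eq′ 1≤w′ isolated′) ⟩
      0ℚ + 0ℚ                      ≡⟨ ℚ.+-identityˡ 0ℚ ⟩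
      0ℚ                           ∎
      where
      isolated′ = unbump-isolated {v} β′ isolated
      1≤w′ = subst (1 ℕ.≤_) (at-bump-≢ β′ w≢v) 1≤w
      v<β′ : toℕ v ℕ.< length β′
      v<β′ = subst (toℕ v ℕ.<_) (length-bump (toℕ v) β′) (at<length (toℕ v) β (subst (1 ℕ.≤_) (sym eq) (s≤s z≤n)))
      eq′ : at β′ (toℕ v) ≡ k
      eq′ = ℕ.suc-injective (trans (sym (at-bump (toℕ v) β′ v<β′)) eq)

-- Growing connected vertex sets along edges

module Growth {n : ℕ} (G : Graph n) (connected : Connected G) where
  open Graph G
  open OnGraph G

  -- The inductive substitute for a support that induces a connected subgraph. Positivity is
  -- demanded at every vertex of the support so that an extension may start from whichever vertex
  -- meets the new edge.
  Good : List ℕ → Set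
  Good β = ∀ (v : Fin n) → 1 ℕ.≤ at β (toℕ v) → 0ℚ < p (toℕ v) β

  private
    v<length : ∀ (β : List ℕ) → length β ≡ n → ∀ (v : Fin n) → toℕ v ℕ.< length β
    v<length β len v = subst (toℕ v ℕ.<_) (sym len) (Fin.toℕ<n v)

    len-zeros : length (zeros n) ≡ n
    len-zeros = length-replicate n

  singleton : Fin n → List ℕ
  singleton v = bump (toℕ v) (zeros n)

  good-singleton : ∀ v → Good (singleton v)
  good-singleton v u 1≤u with u Fin.≟ v
  ... | no u≢v   = ⊥-elim (ℕ.1+n≰n (subst (1 ℕ.≤_)
    (trans (at-bump-≢ (zeros n) (u≢v ∘ Fin.toℕ-injective)) (at-zeros n (toℕ u))) 1≤u))
  ... | yes refl = subst (0ℚ <_) (sym p≡1) 0<1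
    where
    p≡1 : p (toℕ v) (singleton v) ≡ 1ℚ
    p≡1 = begin
      p (toℕ v) (singleton v)
        ≡⟨ p-bump-isolated {v} (v<length (zeros n) len-zeros v) (λ w _ → at-zeros n (toℕ w)) ⟩
      𝟙 (zeros n) + p (toℕ v) (zeros n)
        ≡⟨ cong₂ _+_ (𝟙-true (zeros n) (sum-zeros n)) (p-support (toℕ v) (zeros n) (at-zeros n (toℕ v))) ⟩
      1ℚ + 0ℚ
        ≡⟨ ℚ.+-identityʳ 1ℚ ⟩
      1ℚ ∎

  -- By `p-edge`, p_v at the larger exponent is a positive multiple of a sum of nonnegative terms,
  -- among them p_v at `β` times p_w at y_w, which is positive. `p-symmetric` then carries
  -- positivity from v to every other vertex of the support.
  good-extend : ∀ {β v w} → length β ≡ n → Good β → 1 ℕ.≤ at β (toℕ v) → Adj v w → Good (bump (toℕ w) β)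
  good-extend {β} {v} {w} len good 1≤v v~w u 1≤u =
    *-cancel-pos (ι-nonneg (at β′ (toℕ v)))
      (subst (0ℚ <_) (p-symmetric (toℕ v) (toℕ u) β′) (*-pos (ι-pos 1≤u) pv>0))
    where
    β′ = bump (toℕ w) β
    w< = v<length β len w

    at-w : ∀ γ → length γ ≡ n → 1 ℕ.≤ at (bump (toℕ w) γ) (toℕ w)
    at-w γ len = subst (1 ℕ.≤_) (sym (at-bump (toℕ w) γ (v<length γ len w))) (s≤s z≤n)

    splitting : Split β′ β (singleton w)
    splitting = split-bumpʳ (toℕ w) w< (subst (λ k → Split β β (zeros k)) len (split-zerosʳ β))

    pv>0 : 0ℚ < p (toℕ v) β′
    pv>0 = *-cancel-pos (ι-nonneg (at β′ (toℕ w)))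
      (subst (0ℚ <_) (sym (p-edge (toℕ v) (toℕ w) (S-edge v~w) β′))
        (✶-pos β′
          (λ {γ} {δ} sp → *-nonneg
            (p-nonneg γ (trans (Split.lengthˡ sp) (trans (length-bump (toℕ w) β) len)) v)
            (p-nonneg δ (trans (Split.lengthʳ sp) (trans (length-bump (toℕ w) β) len)) w))
          (∈-splittings β′ splitting)
          (*-pos (good v 1≤v) (good-singleton w w (at-w (zeros n) len-zeros)))))

  -- A walk that starts inside `P` and ends outside must cross its boundary.
  cut-edge : ∀ {P : Fin n → Set} → (∀ u → Dec (P u)) → ∀ {u w} → P u → ¬ P w →
             ∃₂ λ a b → P a × ¬ P b × Adj a b
  cut-edge {P} P? {u} {w} pu ¬pw = go pu (connected u w)
    where
    go : ∀ {u} → P u → Star Adj u w → ∃₂ λ a b → P a × ¬ P b × Adj a b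
    go pu ε = ⊥-elim (¬pw pu)
    go {u} pu (_◅_ {j = x} u~x path) with P? x
    ... | yes px = go px path
    ... | no ¬px = u , x , pu , ¬px , u~x

  -- While a vertex is missing, `cut-edge` yields an edge from a present vertex to an absent one,
  -- and that absent vertex is added. The recursion counts the n - `sum α` missing vertices. It
  -- serves for single good sets and for pairs of them.
  grow : ∀ (Φ : List ℕ → Set) →
    (∀ {α a b} → length α ≡ n → Φ α → 1 ℕ.≤ at α (toℕ a) → Adj a b → Φ (bump (toℕ b) α)) →
    ∀ {α} u → length α ≡ n → All (ℕ._≤ 1) α → 1 ℕ.≤ at α (toℕ u) → Φ α → Φ (ones n)
  grow Φ extend {α} u len α≤1 = go (n ∸ sum α) len α≤1 (ℕ.m+[n∸m]≡n (subst (sum α ℕ.≤_) len (sum≤length α≤1)))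
    where
    go : ∀ k {α} → length α ≡ n → All (ℕ._≤ 1) α → sum α ℕ.+ k ≡ n → 1 ℕ.≤ at α (toℕ u) → Φ α → Φ (ones n)
    go k {α} len α≤1 k≡ 1≤u φ with Fin.any? (λ b → at α (toℕ b) ℕ.≟ 0)
    ... | no full = subst Φ (trans (≡ones α≤1 covered) (cong ones len)) φ
      where
      covered : ∀ i → i ℕ.< length α → 1 ℕ.≤ at α i
      covered i i< = ℕ.n≢0⇒n>0 (λ eq → full (fromℕ< i<n , trans (cong (at α) (Fin.toℕ-fromℕ< i<n)) eq))
        where i<n = subst (i ℕ.<_) len i<
    ... | yes (b , eq) with cut-edge (λ x → 1 ℕ.≤? at α (toℕ x)) 1≤u (λ 1≤b → ℕ.1+n≰n (subst (1 ℕ.≤_) eq 1≤b))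
    go zero {α} len α≤1 k≡ 1≤u φ | yes (b , eq) | _ =
      ⊥-elim (ℕ.<⇒≢ (sum<length (toℕ b) (v<length α len b) α≤1 eq) (trans (sym (ℕ.+-identityʳ (sum α))) (trans k≡ (sym len))))
    go (suc k) {α} len α≤1 k≡ 1≤u φ | yes _ | a , b , 1≤a , 1≰b , a~b = go k
      (trans (length-bump (toℕ b) α) len)
      (bump-≤1 (toℕ b) (ℕ.n<1⇒n≡0 (ℕ.≰⇒> 1≰b)) α≤1)
      (trans (cong (ℕ._+ k) (sum-bump (toℕ b) α b<)) (trans (sym (ℕ.+-suc (sum α) k)) k≡))
      (ℕ.≤-trans 1≤u (at≤at-bump α (toℕ u) b<))
      (extend len φ 1≤a a~b)
      where b< = v<length α len b

  private
    len-bump² : ∀ u v → length (bump (toℕ {n} u) (singleton v)) ≡ n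
    len-bump² u v = trans (length-bump (toℕ u) (singleton v)) (trans (length-bump (toℕ v) (zeros n)) len-zeros)

    len-singleton : ∀ v → length (singleton v) ≡ n
    len-singleton v = trans (length-bump (toℕ v) (zeros n)) len-zeros

    at-singleton : ∀ v → 1 ℕ.≤ at (singleton v) (toℕ v)
    at-singleton v = subst (1 ℕ.≤_) (sym (at-bump (toℕ v) (zeros n) (v<length (zeros n) len-zeros v))) (s≤s z≤n)

    ≢⇒at≡0 : ∀ α {u v : Fin n} → u ≢ v → at α (toℕ u) ≡ 0 → at (bump (toℕ v) α) (toℕ u) ≡ 0
    ≢⇒at≡0 α u≢v eq = trans (at-bump-≢ α (u≢v ∘ Fin.toℕ-injective)) eq

  good-ones : Fin n → Good (ones n)
  good-ones v = grow Good (λ len good 1≤a a~b → good-extend len good 1≤a a~b) v (len-singleton v)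
    (bump-≤1 (toℕ v) (at-zeros n (toℕ v)) (zeros≤1 n)) (at-singleton v) (good-singleton v)

  -- Exactly the data that make one term of `Q₂ ✶ Q₂` positive, whence the bound 2 on both blocks.
  GoodPartition : List ℕ → Set
  GoodPartition α = ∃₂ λ β γ → Split α β γ × (Good β × 2 ℕ.≤ sum β) × (Good γ × 2 ℕ.≤ sum γ)

  -- The new vertex joins the block that contains its neighbour; the other block is untouched.
  good-partition-extend : ∀ {α a b} → length α ≡ n → GoodPartition α → 1 ℕ.≤ at α (toℕ a) → Adj a b →
                          GoodPartition (bump (toℕ b) α)
  good-partition-extend {α} {a} {b} len (β , γ , sp , (goodβ , 2≤β) , (goodγ , 2≤γ)) 1≤a a~b with 1 ℕ.≤? at β (toℕ a)
  ... | yes 1≤aβ = _ , _ , split-bumpˡ (toℕ b) (v<length α len b) sp ,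
    (good-extend lenβ goodβ 1≤aβ a~b , subst (2 ℕ.≤_) (sym (sum-bump (toℕ b) β (v<length β lenβ b))) (ℕ.m≤n⇒m≤1+n 2≤β)) ,
    (goodγ , 2≤γ)
    where lenβ = trans (Split.lengthˡ sp) len
  ... | no 1≰aβ = _ , _ , split-bumpʳ (toℕ b) (v<length α len b) sp ,
    (goodβ , 2≤β) ,
    (good-extend lenγ goodγ 1≤aγ a~b , subst (2 ℕ.≤_) (sym (sum-bump (toℕ b) γ (v<length γ lenγ b))) (ℕ.m≤n⇒m≤1+n 2≤γ))
    where
    lenγ = trans (Split.lengthʳ sp) len
    1≤aγ : 1 ℕ.≤ at γ (toℕ a)
    1≤aγ = subst (1 ℕ.≤_) (trans (sym (Split.at-split sp (toℕ a))) (cong (ℕ._+ at γ (toℕ a)) (ℕ.n<1⇒n≡0 (ℕ.≰⇒> 1≰aβ)))) 1≤a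

  record DisjointEdges : Set where
    constructor disjoint
    field
      {u v x y}           : Fin n
      u~v                 : Adj u v
      x~y                 : Adj x y
      u≢x                 : u ≢ x
      u≢y                 : u ≢ y
      v≢x                 : v ≢ x
      v≢y                 : v ≢ y

  adj⇒≢ : ∀ {u v} → Adj u v → u ≢ v
  adj⇒≢ u~v refl = irrefl refl u~v

  good-partition : DisjointEdges → GoodPartition (ones n)
  good-partition (disjoint {u} {v} {x} {y} u~v x~y u≢x u≢y v≢x v≢y) =
    grow GoodPartition good-partition-extend u
      (trans (length-bump (toℕ u) (bump (toℕ v) (edge x y))) (trans (length-bump (toℕ v) (edge x y)) (len-bump² x y)))
      (bump-≤1 (toℕ u) (≢⇒at≡0 (edge x y) (adj⇒≢ u~v) u₀) (bump-≤1 (toℕ v) v₀ (bump-≤1 (toℕ x) (≢⇒at≡0 (zeros n) (adj⇒≢ x~y) (at-zeros n (toℕ x))) (bump-≤1 (toℕ y) (at-zeros n (toℕ y)) (zeros≤1 n)))))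
      (subst (1 ℕ.≤_) (sym (at-bump (toℕ u) (bump (toℕ v) (edge x y)) u<)) (s≤s z≤n))
      -- The two disjoint edges themselves are the initial blocks.
      (edge u v , edge x y , splitting , (good-edge u~v , 2≤edge u v) , (good-edge x~y , 2≤edge x y))
    where
    edge : Fin n → Fin n → List ℕ
    edge a b = bump (toℕ a) (singleton b)

    2≤edge : ∀ a b → 2 ℕ.≤ sum (edge a b)
    2≤edge a b = ℕ.≤-reflexive (sym (trans (sum-bump (toℕ a) (singleton b) (v<length (singleton b) (len-singleton b) a))
      (cong suc (trans (sum-bump (toℕ b) (zeros n) (v<length (zeros n) len-zeros b)) (cong suc (sum-zeros n))))))

    good-edge : ∀ {a b} → Adj a b → Good (edge a b)
    good-edge {a} {b} a~b = good-extend (len-singleton b) (good-singleton b) (at-singleton b) (symm a~b)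

    v₀ : at (edge x y) (toℕ v) ≡ 0
    v₀ = ≢⇒at≡0 (singleton y) v≢x (≢⇒at≡0 (zeros n) v≢y (at-zeros n (toℕ v)))

    u₀ : at (edge x y) (toℕ u) ≡ 0
    u₀ = ≢⇒at≡0 (singleton y) u≢x (≢⇒at≡0 (zeros n) u≢y (at-zeros n (toℕ u)))

    v< : toℕ v ℕ.< length (edge x y)
    v< = v<length (edge x y) (len-bump² x y) v

    u< : toℕ u ℕ.< length (bump (toℕ v) (edge x y))
    u< = v<length (bump (toℕ v) (edge x y)) (trans (length-bump (toℕ v) (edge x y)) (len-bump² x y)) u

    splitting : Split (bump (toℕ u) (bump (toℕ v) (edge x y))) (edge u v) (edge x y)
    splitting = split-bumpˡ (toℕ u) u< (split-bumpˡ (toℕ v) v<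
      (split-comm (subst (λ k → Split (edge x y) (edge x y) (zeros k)) (len-bump² x y) (split-zerosʳ (edge x y)))))

  ∃-fourth : n ≥ 4 → ∀ u v x → ∃ λ w → w ≢ u × w ≢ v × w ≢ x
  ∃-fourth n≥4 u v x with Fin.any? (λ w → ¬? (w Fin.≟ u) ×-dec (¬? (w Fin.≟ v) ×-dec ¬? (w Fin.≟ x)))
  ... | yes fourth = fourth
  ... | no ¬fourth = ⊥-elim (collision (Fin.pigeonhole n≥4 f))
    where
    f : Fin n → Fin 3
    f w with w Fin.≟ u | w Fin.≟ v
    ... | yes _ | _     = zero
    ... | no _  | yes _ = suc zero
    ... | no _  | no _  = suc (suc zero)

    is-x : ∀ {w} → w ≢ u → w ≢ v → w ≡ x
    is-x {w} w≢u w≢v with w Fin.≟ x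
    ... | yes w≡x = w≡x
    ... | no w≢x  = ⊥-elim (¬fourth (w , w≢u , w≢v , w≢x))

    f-injective : ∀ i j → f i ≡ f j → i ≡ j
    f-injective i j eq with i Fin.≟ u | i Fin.≟ v | j Fin.≟ u | j Fin.≟ v
    f-injective i j eq | yes refl | _        | yes refl | _        = refl
    f-injective i j () | yes _    | _        | no _     | yes _
    f-injective i j () | yes _    | _        | no _     | no _
    f-injective i j () | no _     | yes _    | yes _    | _
    f-injective i j eq | no _     | yes refl | no _     | yes refl = refl
    f-injective i j () | no _     | yes _    | no _     | no _
    f-injective i j () | no _     | no _     | yes _    | _
    f-injective i j () | no _     | no _     | no _     | yes _
    f-injective i j eq | no i≢u   | no i≢v   | no j≢u   | no j≢v   = trans (is-x i≢u i≢v) (sym (is-x j≢u j≢v))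

    collision : ¬ (∃₂ λ i j → i Fin.< j × f i ≡ f j)
    collision (i , j , i<j , eq) = Fin.<⇒≢ i<j (f-injective i j eq)

  -- Among connected graphs with an edge, only stars and the triangle have no two disjoint edges.
  -- Stars are excluded by the hypothesis that every vertex is avoided by an edge, and the triangle
  -- by a fourth vertex.
  disjoint-edges : n ≥ 4 → (∀ c → ∃₂ λ u v → Adj u v × u ≢ c × v ≢ c) → DisjointEdges
  disjoint-edges n≥4 avoid with avoid (fromℕ< n≥4)
  -- An edge avoiding u is either disjoint from uv or leaves v for a third vertex; likewise with u
  -- and v exchanged.
  ... | u , v , u~v , _ with edge-at u v | edge-at v u
    where
    edge-at : ∀ a b → (∃ λ z → Adj b z × z ≢ a) ⊎ (∃₂ λ x y → Adj x y × (x ≢ a × y ≢ a) × (x ≢ b × y ≢ b))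
    edge-at a b with avoid a
    ... | x , y , x~y , x≢a , y≢a with x Fin.≟ b | y Fin.≟ b
    ... | yes refl | _        = inj₁ (y , x~y , y≢a)
    ... | no _     | yes refl = inj₁ (x , symm x~y , x≢a)
    ... | no x≢b   | no y≢b   = inj₂ (x , y , x~y , (x≢a , y≢a) , (x≢b , y≢b))
  ... | inj₂ (x , y , x~y , (x≢u , y≢u) , (x≢v , y≢v)) | _ = disjoint u~v x~y (x≢u ∘ sym) (y≢u ∘ sym) (x≢v ∘ sym) (y≢v ∘ sym)
  ... | inj₁ _ | inj₂ (x , y , x~y , (x≢v , y≢v) , (x≢u , y≢u)) = disjoint u~v x~y (x≢u ∘ sym) (y≢u ∘ sym) (x≢v ∘ sym) (y≢v ∘ sym)
  ... | inj₁ (x , v~x , x≢u) | inj₁ (y , u~y , y≢v) with x Fin.≟ y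
  ... | no x≢y = disjoint v~x u~y (adj⇒≢ (symm u~v)) (y≢v ∘ sym) x≢u x≢y
  -- Now u, v and x form a triangle. Connectedness gives an edge leaving it, which is disjoint from
  -- the side opposite its starting corner.
  ... | yes refl with ∃-fourth n≥4 u v x
  ... | w , w≢u , w≢v , w≢x with cut-edge {P = λ z → (z ≡ u) ⊎ ((z ≡ v) ⊎ (z ≡ x))}
                                   (λ z → (z Fin.≟ u) ⊎-dec ((z Fin.≟ v) ⊎-dec (z Fin.≟ x))) (inj₁ refl)
                                   [ w≢u , [ w≢v , w≢x ]′ ]′
  ... | _ , b , inj₁ refl , b∉ , u~b = disjoint u~b v~x (adj⇒≢ u~v) (x≢u ∘ sym) (b∉ ∘ inj₂ ∘ inj₁) (b∉ ∘ inj₂ ∘ inj₂)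
  ... | _ , b , inj₂ (inj₁ refl) , b∉ , v~b = disjoint v~b u~y (adj⇒≢ (symm u~v)) (y≢v ∘ sym) (b∉ ∘ inj₁) (b∉ ∘ inj₂ ∘ inj₂)
  ... | _ , b , inj₂ (inj₂ refl) , b∉ , x~b = disjoint x~b u~v x≢u y≢v (b∉ ∘ inj₁) (b∉ ∘ inj₂ ∘ inj₁)

-- Transposition of 0-1 matrices

-- The two products run over independent splittings, of `α` and of `μ`, so the sums may be
-- interchanged.
✶-exchange : ∀ F H (K : List ℕ → List ℕ → ℚ) α μ →
  (F ✶ λ γ → (H ✶ K γ) μ) α ≡ (H ✶ λ δ → (F ✶ λ γ → K γ δ) α) μ
✶-exchange F H K α μ = begin
  (F ✶ λ γ → (H ✶ K γ) μ) α
    ≡⟨ ✶-split F (λ γ → (H ✶ K γ) μ) α ⟩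
  ∑ (splittings α) (λ x → F (proj₁ x) * (H ✶ K (proj₂ x)) μ)
    ≡⟨ ∑-cong (splittings α) (λ x → trans (cong (F (proj₁ x) *_) (✶-split H (K (proj₂ x)) μ))
         (sym (∑-*ˡ (splittings μ) (F (proj₁ x)) (λ y → H (proj₁ y) * K (proj₂ x) (proj₂ y))))) ⟩
  ∑ (splittings α) (λ x → ∑ (splittings μ) (λ y → F (proj₁ x) * (H (proj₁ y) * K (proj₂ x) (proj₂ y))))
    ≡⟨ ∑-swap (splittings α) (splittings μ) (λ x y → F (proj₁ x) * (H (proj₁ y) * K (proj₂ x) (proj₂ y))) ⟩
  ∑ (splittings μ) (λ y → ∑ (splittings α) (λ x → F (proj₁ x) * (H (proj₁ y) * K (proj₂ x) (proj₂ y))))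
    ≡⟨ ∑-cong (splittings μ) (λ y → trans
         (∑-cong (splittings α) (λ x → solve 3 (λ f h k → (f :* (h :* k)) := (h :* (f :* k))) refl
            (F (proj₁ x)) (H (proj₁ y)) (K (proj₂ x) (proj₂ y))))
         (trans (∑-*ˡ (splittings α) (H (proj₁ y)) (λ x → F (proj₁ x) * K (proj₂ x) (proj₂ y)))
           (cong (H (proj₁ y) *_) (sym (✶-split F (λ γ → K γ (proj₂ y)) α))))) ⟩
  ∑ (splittings μ) (λ y → H (proj₁ y) * (F ✶ λ γ → K γ (proj₂ y)) α)
    ≡⟨ sym (✶-split H (λ δ → (F ✶ λ γ → K γ δ) α) μ) ⟩
  (H ✶ λ δ → (F ✶ λ γ → K γ δ) α) μ ∎

✶-head-0 : ∀ F G → (∀ i β → F (suc i ∷ β) ≡ 0ℚ) → ∀ a α →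
           (F ✶ G) (a ∷ α) ≡ ((F ∘ (0 ∷_)) ✶ (G ∘ (a ∷_))) α
✶-head-0 F G F₀ zero    α = ✶-0∷ F G α
✶-head-0 F G F₀ (suc a) α = trans (✶-suc∷ F G a α)
  (trans (cong (((F ∘ (0 ∷_)) ✶ (G ∘ (suc a ∷_))) α +_) (✶-zero (a ∷ α) vanish)) (ℚ.+-identityʳ _))
  where
  vanish : ∀ {β γ} → Split (a ∷ α) β γ → F (bump 0 β) * G γ ≡ 0ℚ
  vanish {i ∷ β} {γ} _ = trans (cong (_* G γ) (F₀ i β)) (ℚ.*-zeroˡ (G γ))

e? : ∀ r α → Dec (All (ℕ._≤ 1) α × sum α ≡ r)
e? r α = all? (ℕ._≤? 1) α ×-dec (sum α ℕ.≟ r)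

e-0∷ : ∀ r β → e r (0 ∷ β) ≡ e r β
e-0∷ r β = indicator-⇔ (e? r (0 ∷ β)) (e? r β) (λ { (_ ∷ β≤1 , eq) → β≤1 , eq }) (λ { (β≤1 , eq) → z≤n ∷ β≤1 , eq })

e-1∷ : ∀ r β → e (suc r) (1 ∷ β) ≡ e r β
e-1∷ r β = indicator-⇔ (e? (suc r) (1 ∷ β)) (e? r β)
  (λ { (_ ∷ β≤1 , eq) → β≤1 , ℕ.suc-injective eq }) (λ { (β≤1 , eq) → ℕ.≤-refl ∷ β≤1 , cong suc eq })

e0-suc∷ : ∀ i β → e 0 (suc i ∷ β) ≡ 0ℚ
e0-suc∷ i β = indicator-false (e? 0 (suc i ∷ β)) (λ ())

e-2∷ : ∀ r i β → e r (suc (suc i) ∷ β) ≡ 0ℚ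
e-2∷ r i β = indicator-false (e? r (suc (suc i) ∷ β)) (λ { (s≤s () ∷ _ , _) })

-- For 0-1 matrices with first row sum `m` and first column sum `a`, this is the share with corner
-- entry 1, which uses up one unit of both sums.
diagonal : (ℕ → ℕ → ℚ) → ℕ → ℕ → ℚ
diagonal f (suc m) (suc a) = f m a
diagonal f _       _       = 0ℚ

e✶-∷ : ∀ m G a α → (e m ✶ G) (a ∷ α) ≡
       (e m ✶ (G ∘ (a ∷_))) α + diagonal (λ m a → (e m ✶ (G ∘ (a ∷_))) α) m a
e✶-∷ zero G a α = trans (✶-head-0 (e 0) G e0-suc∷ a α)
  (trans (✶-cong {G = G ∘ (a ∷_)} (e-0∷ 0) (λ _ → refl) α) (sym (ℚ.+-identityʳ _)))
e✶-∷ (suc m) G zero α = trans (✶-0∷ (e (suc m)) G α)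
  (trans (✶-cong {G = G ∘ (0 ∷_)} (e-0∷ (suc m)) (λ _ → refl) α) (sym (ℚ.+-identityʳ _)))
e✶-∷ (suc m) G (suc a) α = trans (✶-suc∷ (e (suc m)) G a α) (cong₂ _+_
  (✶-cong {G = G ∘ (suc a ∷_)} (e-0∷ (suc m)) (λ _ → refl) α)
  (trans (✶-head-0 (e (suc m) ∘ bump 0) G (e-2∷ (suc m)) a α)
    (✶-cong {G = G ∘ (a ∷_)} (e-1∷ m) (λ _ → refl) α)))

∏ : List Series → Series
∏ = foldr _✶_ 𝟙

-- Both sides count 0-1 matrices with row sums `μ` and column sums `a ∷ α`; the right side chooses
-- the first column and leaves row sums `δ`. The induction peels off the first row, compares by
-- corner entry, and uses `✶-exchange` to choose the rest of the first row and of the first column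
-- in either order.
∏e-∷ : ∀ μ a α → ∏ (map e μ) (a ∷ α) ≡ (e a ✶ λ δ → ∏ (map e δ) α) μ
∏e-∷ [] a α = trans (𝟙-∷ a) (sym (✶-[] (e a) (λ δ → ∏ (map e δ) α)))
  where
  𝟙-∷ : ∀ a → 𝟙 (a ∷ α) ≡ e a [] * 𝟙 α
  𝟙-∷ zero    = trans (indicator-⇔ (all? (ℕ._≟ 0) (0 ∷ α)) (all? (ℕ._≟ 0) α) (λ { (_ ∷ z) → z }) (refl ∷_))
    (sym (ℚ.*-identityˡ (𝟙 α)))
  𝟙-∷ (suc a) = sym (ℚ.*-zeroˡ (𝟙 α))
∏e-∷ (m ∷ μ) a α = begin
  (e m ✶ ∏ (map e μ)) (a ∷ α)
    ≡⟨ e✶-∷ m (∏ (map e μ)) a α ⟩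
  rows m a + diagonal rows m a
    ≡⟨ cong₂ _+_ (rows≡cols m a) (diagonals m a) ⟩
  cols a m + diagonal cols a m
    ≡⟨ sym (e✶-∷ a (λ δ → ∏ (map e δ) α) m μ) ⟩
  (e a ✶ λ δ → ∏ (map e δ) α) (m ∷ μ) ∎
  where
  rows cols : ℕ → ℕ → ℚ
  rows m a = (e m ✶ (∏ (map e μ) ∘ (a ∷_))) α
  cols a m = (e a ✶ (λ δ → ∏ (map e (m ∷ δ)) α)) μ

  rows≡cols : ∀ m a → rows m a ≡ cols a m
  rows≡cols m a = trans (✶-cong {F = e m} (λ _ → refl) (∏e-∷ μ a) α)
    (✶-exchange (e m) (e a) (λ γ δ → ∏ (map e δ) γ) α μ)

  diagonals : ∀ m a → diagonal rows m a ≡ diagonal cols a m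
  diagonals zero    zero    = refl
  diagonals zero    (suc a) = refl
  diagonals (suc m) zero    = refl
  diagonals (suc m) (suc a) = rows≡cols m a

-- Transposing a 0-1 matrix exchanges its row sums with its column sums.
∏e-transpose : ∀ μ α → ∏ (map e μ) α ≡ ∏ (map e α) μ
∏e-transpose []          []      = refl
∏e-transpose (m ∷ μ)     []      = begin
  (e m ✶ ∏ (map e μ)) []  ≡⟨ ✶-[] (e m) (∏ (map e μ)) ⟩
  e m [] * ∏ (map e μ) [] ≡⟨ cong (e m [] *_) (∏e-transpose μ []) ⟩
  e m [] * 𝟙 μ            ≡⟨ sym (✶-[] (e m) (λ δ → ∏ (map e δ) μ)) ⟩
  (e m ✶ λ δ → ∏ (map e δ) μ) [] ≡⟨ sym (∏e-∷ [] m μ) ⟩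
  𝟙 (m ∷ μ)               ∎
∏e-transpose μ (a ∷ α) = trans (∏e-∷ μ a α) (✶-cong {F = e a} (λ _ → refl) (λ δ → ∏e-transpose δ α) μ)

e[]≐∏ : ∀ μ → e[ μ ] ≐ ∏ (map e μ)
e[]≐∏ []      α = refl
e[]≐∏ (m ∷ μ) α = trans (cong-app (sym (✶≡⊛ (e m) e[ μ ])) α) (✶-cong {F = e m} (λ _ → refl) (e[]≐∏ μ) α)

-- Linear functionals on series

-- A finite combination of coefficient extractions. The same list is also a noncommutative
-- polynomial in the homogeneous parts of the stable-set series, an exponent being a word in their
-- degrees; this is why `_⊗_` concatenates exponents.
Functional : Set
Functional = List (ℚ × List ℕ)

apply : Functional → Series → ℚ
apply φ F = ∑ φ λ cα → proj₁ cα * F (proj₂ cα)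

infixl 7 _⊗_
_⊗_ : Functional → Functional → Functional
φ ⊗ ψ = cartesianProductWith (λ x y → proj₁ x * proj₁ y , proj₂ x ++ proj₂ y) φ ψ

reweight : (ℕ → ℚ) → Functional → Functional
reweight f = map λ x → f (sum (proj₂ x)) * proj₁ x , proj₂ x

-- The sum of all y^A over stable A, cut off after degree B because a functional must be finite.
generators : ℕ → Functional
generators B = map (λ i → 1ℚ , [ i ]) (upTo (suc B))

negS : ℕ → ℚ
negS zero    = 0ℚ
negS (suc i) = - sgn (suc i)

-- B bounds the degrees in which the functional represents the series of the same name.
geometricᶠ : ℕ → ℕ → Functional
geometricᶠ B zero    = [ 1ℚ , [] ]
geometricᶠ B (suc N) = (1ℚ , []) ∷ reweight negS (generators B) ⊗ geometricᶠ B N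

-- Transparent, this would make conversion checking evaluate sums of rationals.
opaque
  sinkᶠ : ℕ → Functional
  sinkᶠ B = reweight (λ i → - (ι i * sgn i)) (generators B) ⊗ geometricᶠ B B

-- Without the cut at 2, a star would contribute through a single leaf against the connected
-- remainder. With it, the block missing the centre consists of at least two pairwise nonadjacent
-- leaves.
≥2? : ℕ → ℚ
≥2? i = indicator (2 ℕ.≤? i)

opaque
  two-sinksᶠ : ℕ → Functional
  two-sinksᶠ B = reweight ≥2? (sinkᶠ B) ⊗ reweight ≥2? (sinkᶠ B)

∑-indicator : ∀ {ℓ} {P : Set ℓ} (P? : Dec P) N {k} → k ℕ.< N → ∑ (upTo N) (λ i → indicator (P? ×-dec (k ℕ.≟ i))) ≡ indicator P?
∑-indicator P? (suc N) {zero} _ = trans (∑-upTo-suc N (λ i → indicator (P? ×-dec (0 ℕ.≟ i)))) (trans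
  (cong₂ _+_ (indicator-⇔ (P? ×-dec (0 ℕ.≟ 0)) P? proj₁ (_, refl))
    (∑-zero (upTo N) (λ {i} _ → indicator-false (P? ×-dec (0 ℕ.≟ suc i)) (λ ()))))
  (ℚ.+-identityʳ _))
∑-indicator P? (suc N) {suc k} (s≤s k<N) = trans (∑-upTo-suc N (λ i → indicator (P? ×-dec (suc k ℕ.≟ i)))) (trans
  (cong₂ _+_ (indicator-false (P? ×-dec (suc k ℕ.≟ 0)) (λ ()))
    (trans (∑-cong (upTo N) (λ i → indicator-⇔ (P? ×-dec (suc k ℕ.≟ suc i)) (P? ×-dec (k ℕ.≟ i))
        (λ (x , eq) → x , ℕ.suc-injective eq) (λ (x , eq) → x , cong suc eq)))
      (∑-indicator P? N k<N)))
  (ℚ.+-identityˡ _))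

-- Functionals as power series attached to a graph

module Evaluation {n : ℕ} (G : Graph n) where
  open OnGraph G

  sₐ? : ∀ a β → Dec (Stable β × sum β ≡ a)
  sₐ? a β = stable? β ×-dec (sum β ℕ.≟ a)

  s : ℕ → Series
  s a β = indicator (sₐ? a β)

  -- M α β is the coefficient of y^β in the product of the s a, a ∈ α; it is the
  -- coefficient of x^α in X G when β = (1, …, 1), and in e[ β ] when G is edgeless.
  M : List ℕ → Series
  M α = ∏ (map s α)

  M-++ : ∀ α α′ → M (α ++ α′) ≐ M α ✶ M α′
  M-++ []      α′ β = sym (✶-identityˡ (M α′) β)
  M-++ (a ∷ α) α′ β = trans (✶-cong {F = s a} (λ _ → refl) (M-++ α α′) β) (sym (✶-assoc (s a) (M α) (M α′) β))

  M-degree : ∀ α β → sum α ≢ sum β → M α β ≡ 0ℚ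
  M-degree []      β ≢ = 𝟙-false β (ℕ.n≢0⇒n>0 (≢ ∘ sym))
  M-degree (a ∷ α) β ≢ = ✶-zero β λ {γ} {δ} sp → term γ δ (Split.sum-split sp)
    where
    term : ∀ γ δ → sum γ ℕ.+ sum δ ≡ sum β → s a γ * M α δ ≡ 0ℚ
    term γ δ sp with sum γ ℕ.≟ a
    ... | no γ≢a  = trans (cong (_* M α δ) (indicator-false (sₐ? a γ) (γ≢a ∘ proj₂))) (ℚ.*-zeroˡ (M α δ))
    ... | yes γ≡a = trans (cong (s a γ *_) (M-degree α δ (λ α≡δ → ≢ (trans (cong₂ ℕ._+_ (sym γ≡a) α≡δ) sp)))) (ℚ.*-zeroʳ (s a γ))

  ⟦_⟧ : Functional → Series
  ⟦ φ ⟧ β = apply φ (λ α → M α β)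

  ⟦⊗⟧ : ∀ φ ψ → ⟦ φ ⊗ ψ ⟧ ≐ ⟦ φ ⟧ ✶ ⟦ ψ ⟧
  ⟦⊗⟧ φ ψ β = begin
    ⟦ φ ⊗ ψ ⟧ β
      ≡⟨ ∑-cartesianProductWith _ φ ψ (λ cα → proj₁ cα * M (proj₂ cα) β) ⟩
    ∑ φ (λ x → ∑ ψ (λ y → proj₁ x * proj₁ y * M (proj₂ x ++ proj₂ y) β))
      ≡⟨ ∑-cong φ (λ x → trans (∑-cong ψ (λ y → term x y))
           (∑-*ˡ ψ (proj₁ x) (λ y → proj₁ y * (M (proj₂ x) ✶ M (proj₂ y)) β))) ⟩
    ∑ φ (λ x → proj₁ x * ∑ ψ (λ y → proj₁ y * (M (proj₂ x) ✶ M (proj₂ y)) β))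
      ≡⟨ ∑-cong φ (λ x → cong (proj₁ x *_) (sym (trans
           (✶-∑ʳ ψ (M (proj₂ x)) (λ y → proj₁ y · M (proj₂ y)) β)
           (∑-cong ψ (λ y → ✶-·ʳ (proj₁ y) (M (proj₂ x)) (M (proj₂ y))))))) ⟩
    ∑ φ (λ x → proj₁ x * (M (proj₂ x) ✶ ⟦ ψ ⟧) β)
      ≡⟨ ∑-cong φ (λ x → sym (✶-·ˡ (proj₁ x) (M (proj₂ x)) ⟦ ψ ⟧ β)) ⟩
    ∑ φ (λ x → ((proj₁ x · M (proj₂ x)) ✶ ⟦ ψ ⟧) β)
      ≡⟨ sym (✶-∑ˡ φ (λ x → proj₁ x · M (proj₂ x)) ⟦ ψ ⟧ β) ⟩
    (⟦ φ ⟧ ✶ ⟦ ψ ⟧) β ∎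
    where
    ✶-·ʳ : ∀ c F G → (F ✶ (c · G)) β ≡ c * (F ✶ G) β
    ✶-·ʳ c F G = trans (✶-comm F (c · G) β) (trans (✶-·ˡ c G F β) (cong (c *_) (✶-comm G F β)))

    term : ∀ x y → proj₁ x * proj₁ y * M (proj₂ x ++ proj₂ y) β ≡ proj₁ x * (proj₁ y * (M (proj₂ x) ✶ M (proj₂ y)) β)
    term (c , α) (d , α′) = trans (ℚ.*-assoc c d (M (α ++ α′) β)) (cong (λ q → c * (d * q)) (M-++ α α′ β))

  -- `M α` is homogeneous of degree `sum α`, so a weight depending on the word is a weight depending
  -- on the degree of the monomial.
  ⟦reweight⟧ : ∀ f φ β → ⟦ reweight f φ ⟧ β ≡ f (sum β) * ⟦ φ ⟧ β
  ⟦reweight⟧ f φ β = begin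
    ⟦ reweight f φ ⟧ β
      ≡⟨ ∑-map _ φ (λ cα → proj₁ cα * M (proj₂ cα) β) ⟩
    ∑ φ (λ x → f (sum (proj₂ x)) * proj₁ x * M (proj₂ x) β)
      ≡⟨ ∑-cong φ term ⟩
    ∑ φ (λ x → f (sum β) * (proj₁ x * M (proj₂ x) β))
      ≡⟨ ∑-*ˡ φ (f (sum β)) (λ x → proj₁ x * M (proj₂ x) β) ⟩
    f (sum β) * ⟦ φ ⟧ β ∎
    where
    term : ∀ x → f (sum (proj₂ x)) * proj₁ x * M (proj₂ x) β ≡ f (sum β) * (proj₁ x * M (proj₂ x) β)
    term (c , α) with sum α ℕ.≟ sum β
    ... | yes eq = trans (ℚ.*-assoc (f (sum α)) c (M α β)) (cong (λ k → f k * (c * M α β)) eq)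
    ... | no α≢β = trans (cong (f (sum α) * c *_) (M-degree α β α≢β)) (trans (ℚ.*-zeroʳ (f (sum α) * c))
      (sym (trans (cong (λ q → f (sum β) * (c * q)) (M-degree α β α≢β))
        (trans (cong (f (sum β) *_) (ℚ.*-zeroʳ c)) (ℚ.*-zeroʳ (f (sum β)))))))

  ⟦generators⟧ : ∀ B β → sum β ℕ.≤ B → ⟦ generators B ⟧ β ≡ indicator (stable? β)
  ⟦generators⟧ B β ≤B = begin
    ⟦ generators B ⟧ β
      ≡⟨ ∑-map (λ i → 1ℚ , [ i ]) (upTo (suc B)) (λ cα → proj₁ cα * M (proj₂ cα) β) ⟩
    ∑ (upTo (suc B)) (λ i → 1ℚ * (s i ✶ 𝟙) β)
      ≡⟨ ∑-cong (upTo (suc B)) (λ i → trans (ℚ.*-identityˡ ((s i ✶ 𝟙) β)) (✶-identityʳ (s i) β)) ⟩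
    ∑ (upTo (suc B)) (λ i → indicator (stable? β ×-dec (sum β ℕ.≟ i)))
      ≡⟨ ∑-indicator (stable? β) (suc B) (s≤s ≤B) ⟩
    indicator (stable? β) ∎

  ⟦geometric⟧ : ∀ B N β → sum β ℕ.≤ B → ⟦ geometricᶠ B N ⟧ β ≡ geometric U N β
  ⟦geometric⟧ B zero    β ≤B = trans (ℚ.+-identityʳ _) (ℚ.*-identityˡ (𝟙 β))
  ⟦geometric⟧ B (suc N) β ≤B = cong₂ _+_ (ℚ.*-identityˡ (𝟙 β)) (trans
    (⟦⊗⟧ (reweight negS (generators B)) (geometricᶠ B N) β)
    (✶-cong-∈ β (λ {γ} {δ} sp → cong₂ _*_ (U≡ γ (split-≤ˡ sp ≤B)) (⟦geometric⟧ B N δ (split-≤ʳ sp ≤B)))))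
    where
    U≡ : ∀ γ → sum γ ℕ.≤ B → ⟦ reweight negS (generators B) ⟧ γ ≡ U γ
    U≡ γ ≤B = trans (⟦reweight⟧ negS (generators B) γ) (trans (cong (negS (sum γ) *_) (⟦generators⟧ B γ ≤B)) (cases (sum γ) refl))
      where
      i = indicator (stable? γ)
      cases : ∀ k → sum γ ≡ k → negS k * i ≡ 𝟙 γ - S γ
      cases zero    eq = trans (ℚ.*-zeroˡ i) (sym (U₀ γ eq))
      cases (suc k) eq = sym (trans
        (cong₂ _-_ (𝟙-false γ (subst (1 ℕ.≤_) (sym eq) (s≤s z≤n))) (cong (λ l → sgn l * i) eq))
        (solve 2 (λ x i → (con 0ℚ :+ (:- ((:- x) :* i))) := ((:- (:- x)) :* i)) refl (sgn k) i))

  Q : Series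
  Q β = ∑ (allFin n) λ v → p (toℕ v) β

  ι-sum : ∀ {k} γ → length γ ≡ k → ∑ (allFin k) (λ v → ι (at γ (toℕ v))) ≡ ι (sum γ)
  ι-sum {zero}  []      _   = refl
  ι-sum {suc k} (m ∷ γ) len = trans (∑-allFin-suc k (λ v → ι (at (m ∷ γ) (toℕ v))))
    (trans (cong (ι m +_) (ι-sum γ (ℕ.suc-injective len))) (sym (ι-+ m (sum γ))))

  opaque
    unfolding sinkᶠ

    -- The factor - i (-1)^i in `sinkᶠ` is the action of - Σ y_v ∂_v on the part of S of degree i.
    -- The second factor is 1/S, exact up to degree B although the geometric series is truncated.
    ⟦sink⟧ : ∀ B β → length β ≡ n → sum β ℕ.≤ B → ⟦ sinkᶠ B ⟧ β ≡ Q β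
    ⟦sink⟧ B β len ≤B = begin
      ⟦ sinkᶠ B ⟧ β
        ≡⟨ ⟦⊗⟧ (reweight (λ i → - (ι i * sgn i)) (generators B)) (geometricᶠ B B) β ⟩
      (⟦ reweight (λ i → - (ι i * sgn i)) (generators B) ⟧ ✶ ⟦ geometricᶠ B B ⟧) β
        ≡⟨ ✶-cong-∈ β (λ {γ} {δ} sp → cong₂ _*_
             (euler γ (trans (Split.lengthˡ sp) len) (split-≤ˡ sp ≤B))
             (trans (⟦geometric⟧ B B δ (split-≤ʳ sp ≤B)) (geometric-inverse B δ (split-≤ʳ sp ≤B)))) ⟩
      ((λ γ → ∑ (allFin n) (λ v → negD (toℕ v) γ)) ✶ inverse) β
        ≡⟨ ✶-∑ˡ (allFin n) (negD ∘ toℕ) inverse β ⟩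
      Q β ∎
      where
      euler : ∀ γ → length γ ≡ n → sum γ ℕ.≤ B →
              ⟦ reweight (λ i → - (ι i * sgn i)) (generators B) ⟧ γ ≡ ∑ (allFin n) (λ v → negD (toℕ v) γ)
      euler γ len ≤B = begin
        ⟦ reweight (λ i → - (ι i * sgn i)) (generators B) ⟧ γ
          ≡⟨ ⟦reweight⟧ (λ i → - (ι i * sgn i)) (generators B) γ ⟩
        - (ι (sum γ) * sgn (sum γ)) * ⟦ generators B ⟧ γ
          ≡⟨ cong (- (ι (sum γ) * sgn (sum γ)) *_) (⟦generators⟧ B γ ≤B) ⟩
        - (ι (sum γ) * sgn (sum γ)) * indicator (stable? γ)
          ≡⟨ solve 3 (λ k x i → ((:- (k :* x)) :* i) := (k :* (:- (x :* i)))) refl (ι (sum γ)) (sgn (sum γ)) (indicator (stable? γ)) ⟩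
        ι (sum γ) * - S γ
          ≡⟨ cong (_* - S γ) (sym (ι-sum γ len)) ⟩
        ∑ (allFin n) (λ v → ι (at γ (toℕ v))) * - S γ
          ≡⟨ sym (∑-*ʳ (allFin n) (- S γ) (λ v → ι (at γ (toℕ v)))) ⟩
        ∑ (allFin n) (λ v → ι (at γ (toℕ v)) * - S γ)
          ≡⟨ ∑-cong (allFin n) (λ v → solve 2 (λ k s → (k :* (:- s)) := (:- (k :* s))) refl (ι (at γ (toℕ v))) (S γ)) ⟩
        ∑ (allFin n) (λ v → negD (toℕ v) γ) ∎

  Q₂ : Series
  Q₂ β = ≥2? (sum β) * Q β

  opaque
    unfolding two-sinksᶠ

    ⟦two-sinks⟧ : ∀ B β → length β ≡ n → sum β ℕ.≤ B → ⟦ two-sinksᶠ B ⟧ β ≡ (Q₂ ✶ Q₂) β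
    ⟦two-sinks⟧ B β len ≤B = trans (⟦⊗⟧ (reweight ≥2? (sinkᶠ B)) (reweight ≥2? (sinkᶠ B)) β)
      (✶-cong-∈ β λ {γ} {δ} sp → cong₂ _*_
        (half γ (trans (Split.lengthˡ sp) len) (split-≤ˡ sp ≤B))
        (half δ (trans (Split.lengthʳ sp) len) (split-≤ʳ sp ≤B)))
      where
      half : ∀ γ → length γ ≡ n → sum γ ℕ.≤ B → ⟦ reweight ≥2? (sinkᶠ B) ⟧ γ ≡ Q₂ γ
      half γ len ≤B = trans (⟦reweight⟧ ≥2? (sinkᶠ B) γ) (cong (≥2? (sum γ) *_) (⟦sink⟧ B γ len ≤B))

-- Colourings

∑-filter : ∀ {ℓ ℓ′} {A : Set ℓ} {P : A → Set ℓ′} (P? : ∀ x → Dec (P x)) (xs : List A) (f : A → ℚ) →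
           ∑ (filter P? xs) f ≡ ∑ xs (λ x → indicator (P? x) * f x)
∑-filter P? []       f = refl
∑-filter P? (x ∷ xs) f with P? x
... | yes _ = cong₂ _+_ (sym (ℚ.*-identityˡ (f x))) (∑-filter P? xs f)
... | no _  = trans (∑-filter P? xs f) (sym (trans
  (cong (_+ ∑ xs (λ x → indicator (P? x) * f x)) (ℚ.*-zeroˡ (f x))) (ℚ.+-identityˡ _)))

indicator-* : ∀ {ℓ₁ ℓ₂} {P : Set ℓ₁} {Q : Set ℓ₂} (P? : Dec P) (Q? : Dec Q) →
              indicator P? * indicator Q? ≡ indicator (P? ×-dec Q?)
indicator-* (yes _) (yes _) = ℚ.*-identityˡ 1ℚ
indicator-* (yes _) (no _)  = ℚ.*-identityˡ 0ℚ
indicator-* (no _)  Q?      = ℚ.*-zeroˡ (indicator Q?)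

∏ᶠ : ∀ k → (Fin k → ℚ) → ℚ
∏ᶠ zero    f = 1ℚ
∏ᶠ (suc k) f = f zero * ∏ᶠ k (f ∘ suc)

∏ᶠ-indicator : ∀ {ℓ} k {P : Fin k → Set ℓ} (P? : ∀ i → Dec (P i)) → ∏ᶠ k (λ i → indicator (P? i)) ≡ indicator (Fin.all? P?)
∏ᶠ-indicator zero    P? = sym (indicator-true (Fin.all? P?) (λ ()))
∏ᶠ-indicator (suc k) P? = begin
  indicator (P? zero) * ∏ᶠ k (λ i → indicator (P? (suc i)))
    ≡⟨ cong (indicator (P? zero) *_) (∏ᶠ-indicator k (P? ∘ suc)) ⟩
  indicator (P? zero) * indicator (Fin.all? (P? ∘ suc))
    ≡⟨ indicator-* (P? zero) (Fin.all? (P? ∘ suc)) ⟩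
  indicator (P? zero ×-dec Fin.all? (P? ∘ suc))
    ≡⟨ indicator-⇔ (P? zero ×-dec Fin.all? (P? ∘ suc)) (Fin.all? P?)
         (λ { (p₀ , pₛ) zero → p₀ ; (p₀ , pₛ) (suc i) → pₛ i }) (λ p → p zero , p ∘ suc) ⟩
  indicator (Fin.all? P?) ∎

∏ˢ : ∀ k → (Fin k → Series) → Series
∏ˢ zero    f = 𝟙
∏ˢ (suc k) f = f zero ✶ ∏ˢ k (f ∘ suc)

δ : ∀ {k} → Fin k → Fin k → ℕ
δ i c = if does (i Fin.≟ c) then 1 else 0

∏ˢ-0∷ : ∀ k (f : Fin k → Series) β → ∏ˢ k f (0 ∷ β) ≡ ∏ˢ k (λ i → f i ∘ (0 ∷_)) β
∏ˢ-0∷ zero    f β = indicator-⇔ (all? (ℕ._≟ 0) (0 ∷ β)) (all? (ℕ._≟ 0) β) (λ { (_ ∷ z) → z }) (refl ∷_)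
∏ˢ-0∷ (suc k) f β = trans (✶-0∷ (f zero) (∏ˢ k (f ∘ suc)) β) (✶-cong {F = f zero ∘ (0 ∷_)} (λ _ → refl) (∏ˢ-0∷ k (f ∘ suc)) β)

-- The first variable occurs once, so exactly one factor takes it; the index of that factor is the
-- colour of the first vertex.
∏ˢ-1∷ : ∀ k (f : Fin k → Series) β → ∏ˢ k f (1 ∷ β) ≡ ∑ (allFin k) λ c → ∏ˢ k (λ i → f i ∘ (δ i c ∷_)) β
∏ˢ-1∷ zero    f β = refl
∏ˢ-1∷ (suc k) f β = begin
  (f zero ✶ R) (1 ∷ β)
    ≡⟨ ✶-suc∷ (f zero) R 0 β ⟩
  ((f zero ∘ (0 ∷_)) ✶ (R ∘ (1 ∷_))) β + ((f zero ∘ bump 0) ✶ R) (0 ∷ β)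
    ≡⟨ ℚ.+-comm (((f zero ∘ (0 ∷_)) ✶ (R ∘ (1 ∷_))) β) (((f zero ∘ bump 0) ✶ R) (0 ∷ β)) ⟩
  ((f zero ∘ bump 0) ✶ R) (0 ∷ β) + ((f zero ∘ (0 ∷_)) ✶ (R ∘ (1 ∷_))) β
    ≡⟨ cong₂ _+_
         (trans (✶-0∷ (f zero ∘ bump 0) R β) (✶-cong {F = f zero ∘ (1 ∷_)} (λ _ → refl) (∏ˢ-0∷ k (f ∘ suc)) β))
         (trans (✶-cong {F = f zero ∘ (0 ∷_)} (λ _ → refl) (∏ˢ-1∷ k (f ∘ suc)) β)
           (✶-∑ʳ (allFin k) (f zero ∘ (0 ∷_)) (λ c → ∏ˢ k (λ i → f (suc i) ∘ (δ i c ∷_))) β)) ⟩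
  coloured zero + ∑ (allFin k) (coloured ∘ suc)
    ≡⟨ sym (∑-allFin-suc k coloured) ⟩
  ∑ (allFin (suc k)) coloured ∎
  where
  R = ∏ˢ k (f ∘ suc)
  coloured : Fin (suc k) → ℚ
  coloured c = ∏ˢ (suc k) (λ i → f i ∘ (δ i c ∷_)) β

colour-class : ∀ {n k} → Fin k → Vec (Fin k) n → List ℕ
colour-class i []      = []
colour-class i (c ∷ κ) = δ i c ∷ colour-class i κ

-- Choosing the factor that takes each vertex, one vertex after another, is choosing a colouring.
∏ˢ-ones : ∀ n k (f : Fin k → Series) → ∏ˢ k f (ones n) ≡ ∑ (colourings n k) λ κ → ∏ᶠ k (λ i → f i (colour-class i κ))
∏ˢ-ones zero    k f = trans (base k f) (sym (ℚ.+-identityʳ _))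
  where
  base : ∀ k (f : Fin k → Series) → ∏ˢ k f [] ≡ ∏ᶠ k (λ i → f i [])
  base zero    f = refl
  base (suc k) f = trans (✶-[] (f zero) (∏ˢ k (f ∘ suc))) (cong (f zero [] *_) (base k (f ∘ suc)))
∏ˢ-ones (suc n) k f = begin
  ∏ˢ k f (1 ∷ ones n)
    ≡⟨ ∏ˢ-1∷ k f (ones n) ⟩
  ∑ (allFin k) (λ c → ∏ˢ k (λ i → f i ∘ (δ i c ∷_)) (ones n))
    ≡⟨ ∑-cong (allFin k) (λ c → ∏ˢ-ones n k (λ i → f i ∘ (δ i c ∷_))) ⟩
  ∑ (allFin k) (λ c → ∑ (colourings n k) (λ κ → ∏ᶠ k (λ i → f i (δ i c ∷ colour-class i κ))))
    ≡⟨ sym (∑-cartesianProductWith _∷_ (allFin k) (colourings n k) (λ κ → ∏ᶠ k (λ i → f i (colour-class i κ)))) ⟩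
  ∑ (colourings (suc n) k) (λ κ → ∏ᶠ k (λ i → f i (colour-class i κ))) ∎

sum-colour-class : ∀ {n k} (i : Fin k) (κ : Vec (Fin k) n) → sum (colour-class i κ) ≡ Vec.count (i Fin.≟_) κ
sum-colour-class i []      = refl
sum-colour-class i (c ∷ κ) with i Fin.≟ c
... | yes _ = cong suc (sum-colour-class i κ)
... | no _  = sum-colour-class i κ

at-colour-class : ∀ {n k} (i : Fin k) (κ : Vec (Fin k) n) u → 1 ℕ.≤ at (colour-class i κ) (toℕ u) → i ≡ Vec.lookup κ u
at-colour-class i (c ∷ κ) zero    1≤ with i Fin.≟ c
... | yes i≡c = i≡c
... | no _    = ⊥-elim (ℕ.1+n≰n 1≤)
at-colour-class i (c ∷ κ) (suc u) 1≤ = at-colour-class i κ u 1≤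

at-own-class : ∀ {n k} (κ : Vec (Fin k) n) u i → i ≡ Vec.lookup κ u → 1 ℕ.≤ at (colour-class i κ) (toℕ u)
at-own-class (c ∷ κ) zero    i i≡c with i Fin.≟ c
... | yes _  = ℕ.≤-refl
... | no i≢c = ⊥-elim (i≢c i≡c)
at-own-class (c ∷ κ) (suc u) i eq = at-own-class κ u i eq

colour-class-≤1 : ∀ {n k} (i : Fin k) (κ : Vec (Fin k) n) → All (ℕ._≤ 1) (colour-class i κ)
colour-class-≤1 i []      = []
colour-class-≤1 i (c ∷ κ) with does (i Fin.≟ c)
... | true  = ℕ.≤-refl ∷ colour-class-≤1 i κ
... | false = z≤n ∷ colour-class-≤1 i κ

tabulate-injective : ∀ {ℓ} {A : Set ℓ} {k} (f g : Fin k → A) → tabulate f ≡ tabulate g → ∀ i → f i ≡ g i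
tabulate-injective f g eq zero    = proj₁ (∷-injective eq)
tabulate-injective f g eq (suc i) = tabulate-injective (f ∘ suc) (g ∘ suc) (proj₂ (∷-injective eq)) i

-- Chromatic symmetric functions as coefficients of stable-set products

module Chromatic {n : ℕ} (G : Graph n) where
  open Graph G
  open OnGraph G
  open Evaluation G

  M≡∏ˢ : ∀ α → M α ≡ ∏ˢ (length α) (λ i → s (lookup α i))
  M≡∏ˢ []      = refl
  M≡∏ˢ (a ∷ α) = cong (s a ✶_) (M≡∏ˢ α)

  -- A colouring is proper with exponent `α` exactly when its i-th colour class is stable with α_i
  -- vertices, for every i.
  X≡M : ∀ α → X G α ≡ M α (ones n)
  X≡M α = begin
    X G α
      ≡⟨ ∑-filter (proper? G) (colourings n k) (λ κ → indicator (≡-dec ℕ._≟_ (exponent κ) α)) ⟩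
    ∑ (colourings n k) (λ κ → indicator (proper? G κ) * indicator (≡-dec ℕ._≟_ (exponent κ) α))
      ≡⟨ ∑-cong (colourings n k) per-colouring ⟩
    ∑ (colourings n k) (λ κ → ∏ᶠ k (λ i → s (lookup α i) (colour-class i κ)))
      ≡⟨ sym (∏ˢ-ones n k (λ i → s (lookup α i))) ⟩
    ∏ˢ k (λ i → s (lookup α i)) (ones n)
      ≡⟨ sym (cong-app (M≡∏ˢ α) (ones n)) ⟩
    M α (ones n) ∎
    where
    k = length α

    per-colouring : ∀ (κ : Vec (Fin k) n) → indicator (proper? G κ) * indicator (≡-dec ℕ._≟_ (exponent κ) α) ≡
                    ∏ᶠ k (λ i → s (lookup α i) (colour-class i κ))
    per-colouring κ = begin
      indicator (proper? G κ) * indicator (≡-dec ℕ._≟_ (exponent κ) α)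
        ≡⟨ indicator-* (proper? G κ) (≡-dec ℕ._≟_ (exponent κ) α) ⟩
      indicator (proper? G κ ×-dec ≡-dec ℕ._≟_ (exponent κ) α)
        ≡⟨ indicator-⇔ (proper? G κ ×-dec ≡-dec ℕ._≟_ (exponent κ) α)
             (Fin.all? λ i → sₐ? (lookup α i) (colour-class i κ)) to from ⟩
      indicator (Fin.all? λ i → sₐ? (lookup α i) (colour-class i κ))
        ≡⟨ sym (∏ᶠ-indicator k (λ i → sₐ? (lookup α i) (colour-class i κ))) ⟩
      ∏ᶠ k (λ i → s (lookup α i) (colour-class i κ)) ∎
      where
      count : Fin k → ℕ
      count i = Vec.count (i Fin.≟_) κ

      to : Proper G κ × exponent κ ≡ α → ∀ i → Stable (colour-class i κ) × sum (colour-class i κ) ≡ lookup α i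
      to (proper , eq) i =
        ( colour-class-≤1 i κ
        , λ u v u~v (1≤u , 1≤v) → proper u v u~v (trans (sym (at-colour-class i κ u 1≤u)) (at-colour-class i κ v 1≤v)))
        , trans (sum-colour-class i κ) (tabulate-injective count (lookup α) (trans eq (sym (tabulate-lookup α))) i)

      from : (∀ i → Stable (colour-class i κ) × sum (colour-class i κ) ≡ lookup α i) → Proper G κ × exponent κ ≡ α
      from st =
        (λ u v u~v eq → proj₂ (proj₁ (st (Vec.lookup κ u))) u v u~v
          (at-own-class κ u (Vec.lookup κ u) refl , at-own-class κ v (Vec.lookup κ u) eq))
        , trans (tabulate-cong (λ i → trans (sym (sum-colour-class i κ)) (proj₂ (st i)))) (tabulate-lookup α)

  apply-X : ∀ φ → apply φ (X G) ≡ ⟦ φ ⟧ (ones n)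
  apply-X φ = ∑-cong φ (λ cα → cong (proj₁ cα *_) (X≡M (proj₂ cα)))

  Q-nonneg : ∀ β → length β ≡ n → 0ℚ ≤ Q β
  Q-nonneg β len = ∑-nonneg (allFin n) (λ {v} _ → p-nonneg β len v)

  Q₂-nonneg : ∀ β → length β ≡ n → 0ℚ ≤ Q₂ β
  Q₂-nonneg β len = *-nonneg (indicator-nonneg (2 ℕ.≤? sum β)) (Q-nonneg β len)

  Q₂✶Q₂-nonneg : ∀ β → length β ≡ n → 0ℚ ≤ (Q₂ ✶ Q₂) β
  Q₂✶Q₂-nonneg β len = ✶-nonneg β λ {γ} {δ} sp →
    *-nonneg (Q₂-nonneg γ (trans (Split.lengthˡ sp) len)) (Q₂-nonneg δ (trans (Split.lengthʳ sp) len))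

  apply-sink-X : apply (sinkᶠ n) (X G) ≡ Q (ones n)
  apply-sink-X = trans (apply-X (sinkᶠ n)) (⟦sink⟧ n (ones n) (length-replicate n) (ℕ.≤-reflexive (sum-ones n)))

  apply-two-sinks-X : apply (two-sinksᶠ n) (X G) ≡ (Q₂ ✶ Q₂) (ones n)
  apply-two-sinks-X = trans (apply-X (two-sinksᶠ n)) (⟦two-sinks⟧ n (ones n) (length-replicate n) (ℕ.≤-reflexive (sum-ones n)))

module ConnectedChromatic {n : ℕ} (G : Graph n) (connected : Connected G) where
  open OnGraph G
  open Evaluation G
  open Chromatic G
  open Growth G connected

  Q-pos : ∀ {β} → length β ≡ n → Good β → 1 ℕ.≤ sum β → 0ℚ < Q β
  Q-pos {β} len good 1≤ with Fin.any? (λ (v : Fin n) → 1 ℕ.≤? at β (toℕ v))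
  ... | yes (v , 1≤v) = ∑-pos (λ {u} _ → p-nonneg β len u) (∈-allFin v) (good v 1≤v)
  ... | no ¬v = ⊥-elim (ℕ.<⇒≢ 1≤ (sym (all-0 β (λ i i< → ℕ.n<1⇒n≡0 (ℕ.≰⇒> λ 1≤i →
      ¬v (fromℕ< (subst (i ℕ.<_) len i<) , subst (λ j → 1 ℕ.≤ at β j) (sym (Fin.toℕ-fromℕ< (subst (i ℕ.<_) len i<))) 1≤i))))))
    where
    all-0 : ∀ β → (∀ i → i ℕ.< length β → at β i ≡ 0) → sum β ≡ 0
    all-0 []      _ = refl
    all-0 (m ∷ β) z = cong₂ ℕ._+_ (z 0 (s≤s z≤n)) (all-0 β (λ i i< → z (suc i) (s≤s i<)))

  Q₂-pos : ∀ {β} → length β ≡ n → Good β → 2 ℕ.≤ sum β → 0ℚ < Q₂ β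
  Q₂-pos {β} len good 2≤ = subst (0ℚ <_) (sym (trans (cong (_* Q β) (indicator-true (2 ℕ.≤? sum β) 2≤)) (ℚ.*-identityˡ (Q β))))
    (Q-pos len good (ℕ.<⇒≤ 2≤))

  sink-X-pos : n ≥ 4 → 0ℚ < apply (sinkᶠ n) (X G)
  sink-X-pos n≥4 = subst (0ℚ <_) (sym apply-sink-X)
    (Q-pos (length-replicate n) (good-ones (fromℕ< n≥4)) (subst (1 ℕ.≤_) (sym (sum-ones n)) (ℕ.≤-trans (s≤s z≤n) n≥4)))

  two-sinks-X-pos : DisjointEdges → 0ℚ < apply (two-sinksᶠ n) (X G)
  two-sinks-X-pos edges = subst (0ℚ <_) (sym apply-two-sinks-X) (pos (good-partition edges))
    where
    len = length-replicate n

    pos : GoodPartition (ones n) → 0ℚ < (Q₂ ✶ Q₂) (ones n)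
    pos (β , γ , sp , (goodβ , 2≤β) , (goodγ , 2≤γ)) = ✶-pos (ones n)
      (λ {γ} {δ} sp → *-nonneg (Q₂-nonneg γ (trans (Split.lengthˡ sp) len)) (Q₂-nonneg δ (trans (Split.lengthʳ sp) len)))
      (∈-splittings (ones n) sp)
      (*-pos (Q₂-pos (trans (Split.lengthˡ sp) len) goodβ 2≤β) (Q₂-pos (trans (Split.lengthʳ sp) len) goodγ 2≤γ))

-- Relabelling the centre of a star

-- Substituting permuted variables is a ring homomorphism; stated for maps of exponents.
Multiplicative : (List ℕ → List ℕ) → Set
Multiplicative h = ∀ F G β → (F ✶ G) (h β) ≡ ((F ∘ h) ✶ (G ∘ h)) β

under : (List ℕ → List ℕ) → List ℕ → List ℕ
under h []      = []
under h (m ∷ α) = m ∷ h α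

exchange : List ℕ → List ℕ
exchange []          = []
exchange (m ∷ [])    = m ∷ []
exchange (m ∷ l ∷ α) = l ∷ m ∷ α

-- A cycle written as a composite of adjacent transpositions, so that multiplicativity reduces to
-- that of `exchange`. It carries a star centred at vertex 0 to one centred at vertex i.
insert-head-at : ℕ → List ℕ → List ℕ
insert-head-at zero    = id
insert-head-at (suc i) = under (insert-head-at i) ∘ exchange

under-multiplicative : ∀ {h} → Multiplicative h → Multiplicative (under h)
under-multiplicative {h} mult F G [] = trans (✶-[] F G) (sym (✶-[] (F ∘ under h) (G ∘ under h)))
under-multiplicative {h} mult F G (m ∷ α) = trans (✶-∷ F G m (h α)) (trans
  (∑-cong (upTo (suc m)) (λ i → mult (F ∘ (i ∷_)) (G ∘ (m ∸ i ∷_)) α))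
  (sym (✶-∷ (F ∘ under h) (G ∘ under h) m α)))

exchange-multiplicative : Multiplicative exchange
exchange-multiplicative F G [] = trans (✶-[] F G) (sym (✶-[] (F ∘ exchange) (G ∘ exchange)))
exchange-multiplicative F G (m ∷ []) = trans (✶-∷ F G m []) (trans
  (∑-cong (upTo (suc m)) (λ i → trans (✶-[] (F ∘ (i ∷_)) (G ∘ (m ∸ i ∷_)))
    (sym (✶-[] (F ∘ exchange ∘ (i ∷_)) (G ∘ exchange ∘ (m ∸ i ∷_))))))
  (sym (✶-∷ (F ∘ exchange) (G ∘ exchange) m [])))
exchange-multiplicative F G (m ∷ l ∷ α) = begin
  (F ✶ G) (l ∷ m ∷ α)
    ≡⟨ ✶-∷ F G l (m ∷ α) ⟩
  ∑ (upTo (suc l)) (λ j → ((F ∘ (j ∷_)) ✶ (G ∘ (l ∸ j ∷_))) (m ∷ α))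
    ≡⟨ ∑-cong (upTo (suc l)) (λ j → ✶-∷ (F ∘ (j ∷_)) (G ∘ (l ∸ j ∷_)) m α) ⟩
  ∑ (upTo (suc l)) (λ j → ∑ (upTo (suc m)) (λ i → term i j))
    ≡⟨ ∑-swap (upTo (suc l)) (upTo (suc m)) (λ j i → term i j) ⟩
  ∑ (upTo (suc m)) (λ i → ∑ (upTo (suc l)) (λ j → term i j))
    ≡⟨ ∑-cong (upTo (suc m)) (λ i → sym (✶-∷ (F ∘ exchange ∘ (i ∷_)) (G ∘ exchange ∘ (m ∸ i ∷_)) l α)) ⟩
  ∑ (upTo (suc m)) (λ i → ((F ∘ exchange ∘ (i ∷_)) ✶ (G ∘ exchange ∘ (m ∸ i ∷_))) (l ∷ α))
    ≡⟨ sym (✶-∷ (F ∘ exchange) (G ∘ exchange) m (l ∷ α)) ⟩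
  ((F ∘ exchange) ✶ (G ∘ exchange)) (m ∷ l ∷ α) ∎
  where
  term : ℕ → ℕ → ℚ
  term i j = ((F ∘ (j ∷_) ∘ (i ∷_)) ✶ (G ∘ (l ∸ j ∷_) ∘ (m ∸ i ∷_))) α

insert-multiplicative : ∀ i → Multiplicative (insert-head-at i)
insert-multiplicative zero    F G β = refl
insert-multiplicative (suc i) F G β = trans
  (under-multiplicative (insert-multiplicative i) F G (exchange β))
  (exchange-multiplicative (F ∘ under (insert-head-at i)) (G ∘ under (insert-head-at i)) β)

insert-↭ : ∀ i α → insert-head-at i α ↭ α
insert-↭ zero    α           = Perm.refl
insert-↭ (suc i) []          = Perm.refl
insert-↭ (suc i) (m ∷ [])    = Perm.prep m (insert-↭ i [])
insert-↭ (suc i) (m ∷ l ∷ α) = Perm.trans (Perm.prep l (insert-↭ i (m ∷ α))) (Perm.swap l m Perm.refl)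

at-insert : ∀ i α → i ℕ.< length α → at (insert-head-at i α) i ≡ at α 0
at-insert zero    α           _        = refl
at-insert (suc i) (m ∷ [])    (s≤s ())
at-insert (suc i) (m ∷ l ∷ α) (s≤s i<) = at-insert i (m ∷ α) i<

insert-ones : ∀ i k → insert-head-at i (ones k) ≡ ones k
insert-ones zero    k             = refl
insert-ones (suc i) zero          = refl
insert-ones (suc i) (suc zero)    = cong (1 ∷_) (insert-ones i 0)
insert-ones (suc i) (suc (suc k)) = cong (1 ∷_) (insert-ones i (suc k))

at+at≤sum : ∀ α {i j} → i ≢ j → at α i ℕ.+ at α j ℕ.≤ sum α
at+at≤sum []                        i≢j = z≤n
at+at≤sum (m ∷ α) {zero}  {zero}  i≢j = ⊥-elim (i≢j refl)
at+at≤sum (m ∷ α) {zero}  {suc j} i≢j = ℕ.+-monoʳ-≤ m (at≤sum α j)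
at+at≤sum (m ∷ α) {suc i} {zero}  i≢j = subst (ℕ._≤ m ℕ.+ sum α) (ℕ.+-comm m (at α i)) (ℕ.+-monoʳ-≤ m (at≤sum α i))
at+at≤sum (m ∷ α) {suc i} {suc j} i≢j = ℕ.≤-trans (at+at≤sum α (i≢j ∘ cong suc)) (ℕ.m≤n+m (sum α) m)

sum≡at : ∀ α i → (∀ j → j ℕ.< length α → j ≢ i → at α j ≡ 0) → sum α ≡ at α i
sum≡at []      i       z = refl
sum≡at (m ∷ α) zero    z = trans (cong (m ℕ.+_) (sum-0 α (λ j j< → z (suc j) (s≤s j<) (λ ())))) (ℕ.+-identityʳ m)
  where
  sum-0 : ∀ α → (∀ j → j ℕ.< length α → at α j ≡ 0) → sum α ≡ 0
  sum-0 []      _ = refl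
  sum-0 (m ∷ α) z = cong₂ ℕ._+_ (z 0 (s≤s z≤n)) (sum-0 α (λ j j< → z (suc j) (s≤s j<)))
sum≡at (m ∷ α) (suc i) z = cong₂ ℕ._+_ (z 0 (s≤s z≤n) (λ ())) (sum≡at α i (λ j j< j≢i → z (suc j) (s≤s j<) (j≢i ∘ ℕ.suc-injective)))

record StarAt {n : ℕ} (c : Fin n) (G : Graph n) : Set where
  open Graph G
  field
    incident : ∀ {u v} → Adj u v → u ≡ c ⊎ v ≡ c
    spoke    : ∀ {w} → w ≢ c → Adj c w

module StarSeries {n : ℕ} (G : Graph n) (c : Fin n) (isStar : StarAt c G) where
  open Graph G
  open StarAt isStar
  open OnGraph G
  open Evaluation G
  open Chromatic G

  private
    i = toℕ c

  -- A stable set of a star omits the centre or is the centre alone. The formulation uses only the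
  -- centre's entry and the total, both of which can be followed through a relabelling.
  stable⇒central : ∀ {β} → length β ≡ n → Stable β → at β i ≡ 0 ⊎ sum β ≡ at β i
  stable⇒central {β} len (_ , indep) with 1 ℕ.≤? at β i
  ... | no 1≰  = inj₁ (ℕ.n<1⇒n≡0 (ℕ.≰⇒> 1≰))
  ... | yes 1≤ = inj₂ (sum≡at β i λ j j< j≢i → leaf j (subst (j ℕ.<_) len j<) j≢i)
    where
    leaf : ∀ j → j ℕ.< n → j ≢ i → at β j ≡ 0
    leaf j j<n j≢i = subst (λ k → at β k ≡ 0) (Fin.toℕ-fromℕ< j<n) (ℕ.n<1⇒n≡0 (ℕ.≰⇒> λ 1≤j →
      indep c (fromℕ< j<n) (spoke (λ eq → j≢i (trans (sym (Fin.toℕ-fromℕ< j<n)) (cong toℕ eq)))) (1≤ , 1≤j)))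

  central⇒stable : ∀ {β} → All (ℕ._≤ 1) β → at β i ≡ 0 ⊎ sum β ≡ at β i → Stable β
  central⇒stable {β} β≤1 central = β≤1 , λ u v u~v (1≤u , 1≤v) → [ excludes 1≤u 1≤v (λ u≡v → irrefl u≡v u~v) , (λ v≡c → excludes 1≤v 1≤u (λ v≡u → irrefl (sym v≡u) u~v) v≡c) ]′ (incident u~v)
    where
    excludes : ∀ {u v} → 1 ℕ.≤ at β (toℕ u) → 1 ℕ.≤ at β (toℕ v) → u ≢ v → u ≡ c → ⊥
    excludes {v = v} 1≤c 1≤v c≢v refl = [ (λ eq → ℕ.1+n≰n (subst (1 ℕ.≤_) eq 1≤c))
      , (λ eq → ℕ.1+n≰n (ℕ.≤-trans (ℕ.m<m+n (at β i) 1≤v)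
          (subst (at β i ℕ.+ at β (toℕ v) ℕ.≤_) eq (at+at≤sum β (c≢v ∘ Fin.toℕ-injective))))) ]′ central

central? : ∀ a β → Dec ((All (ℕ._≤ 1) β × (at β 0 ≡ 0 ⊎ sum β ≡ at β 0)) × sum β ≡ a)
central? a β = (all? (ℕ._≤? 1) β ×-dec ((at β 0 ℕ.≟ 0) ⊎-dec (sum β ℕ.≟ at β 0))) ×-dec (sum β ℕ.≟ a)

-- The factors of X for a star whose centre is vertex 0.
star-factor : ℕ → Series
star-factor a β = indicator (central? a β)

module _ {n : ℕ} (G : Graph n) (c : Fin n) (isStar : StarAt c G) where
  open OnGraph G
  open Evaluation G
  open Chromatic G
  open StarSeries G c isStar

  private
    h = insert-head-at (toℕ c)

  s-insert : ∀ a β → length β ≡ n → s a (h β) ≡ star-factor a β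
  s-insert a β len = indicator-⇔ (sₐ? a (h β)) (central? a β)
    (λ (st , eq) →
      ( All-resp-↭ (insert-↭ (toℕ c) β) (proj₁ st)
      , [ inj₁ ∘ trans (sym at-h) , (λ eq → inj₂ (trans (sym sum-h) (trans eq at-h))) ]′ (stable⇒central len-h st))
      , trans (sym sum-h) eq)
    (λ ((β≤1 , central) , eq) →
      central⇒stable (All-resp-↭ (↭-sym (insert-↭ (toℕ c) β)) β≤1)
        ([ inj₁ ∘ trans at-h , (λ eq → inj₂ (trans sum-h (trans eq (sym at-h)))) ]′ central)
      , trans sum-h eq)
    where
    at-h : at (h β) (toℕ c) ≡ at β 0
    at-h = at-insert (toℕ c) β (subst (toℕ c ℕ.<_) (sym len) (Fin.toℕ<n c))
    sum-h : sum (h β) ≡ sum β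
    sum-h = sum-↭ (insert-↭ (toℕ c) β)
    len-h : length (h β) ≡ n
    len-h = trans (↭-length (insert-↭ (toℕ c) β)) len

  M-insert : ∀ α β → length β ≡ n → M α (h β) ≡ ∏ (map star-factor α) β
  M-insert []      β _   = indicator-⇔ (all? (ℕ._≟ 0) (h β)) (all? (ℕ._≟ 0) β)
    (All-resp-↭ (insert-↭ (toℕ c) β)) (All-resp-↭ (↭-sym (insert-↭ (toℕ c) β)))
  M-insert (a ∷ α) β len = trans (insert-multiplicative (toℕ c) (s a) (M α) β)
    (✶-cong-∈ β λ {γ} {δ} sp → cong₂ _*_ (s-insert a γ (trans (Split.lengthˡ sp) len)) (M-insert α δ (trans (Split.lengthʳ sp) len)))

  -- The all-ones exponent is fixed by every relabelling. The right side mentions neither `G` nor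
  -- `c`, so any two stars on n vertices have the same chromatic symmetric function.
  X-star : ∀ α → X G α ≡ ∏ (map star-factor α) (ones n)
  X-star α = trans (X≡M α) (trans (cong (M α) (sym (insert-ones (toℕ c) n))) (M-insert α (ones n) (length-replicate n)))

-- Stars among connected graphs

star-StarAt : ∀ {n} (c : Fin n) → IsCentre c → StarAt c (star n)
star-StarAt c centre = record
  { incident = λ { (_ , inj₁ u-centre) → inj₁ (unique u-centre) ; (_ , inj₂ v-centre) → inj₂ (unique v-centre) }
  ; spoke    = λ w≢c → (w≢c ∘ sym) , inj₁ centre
  }
  where
  unique : ∀ {u} → IsCentre u → u ≡ c
  unique eq = Fin.toℕ-injective (ℕ.suc-injective (trans eq (sym centre)))

Avoidable : ∀ {n} → Graph n → Fin n → Set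
Avoidable G c = ∃₂ λ u v → Graph.Adj G u v × u ≢ c × v ≢ c

avoidable? : ∀ {n} (G : Graph n) c → Dec (Avoidable G c)
avoidable? G c = Fin.any? λ u → Fin.any? λ v → Graph.adj? G u v ×-dec (¬? (u Fin.≟ c) ×-dec ¬? (v Fin.≟ c))

-- If every edge passes through c, then the edge that connectedness provides at any other vertex has
-- to end at c.
unavoidable⇒StarAt : ∀ {n} (G : Graph n) → Connected G → ∀ c → ¬ Avoidable G c → StarAt c G
unavoidable⇒StarAt G connected c ¬avoid = record { incident = incident ; spoke = spoke }
  where
  open Graph G
  open Growth G connected

  incident : ∀ {u v} → Adj u v → u ≡ c ⊎ v ≡ c
  incident {u} {v} u~v with u Fin.≟ c | v Fin.≟ c
  ... | yes u≡c | _       = inj₁ u≡c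
  ... | no _    | yes v≡c = inj₂ v≡c
  ... | no u≢c  | no v≢c  = ⊥-elim (¬avoid (u , v , u~v , u≢c , v≢c))

  spoke : ∀ {w} → w ≢ c → Adj c w
  spoke {w} w≢c with cut-edge {P = _≡ w} (Fin._≟ w) refl (w≢c ∘ sym)
  ... | _ , b , refl , _ , w~b with incident w~b
  ... | inj₁ w≡c = ⊥-elim (w≢c w≡c)
  ... | inj₂ refl = symm w~b

∃-other : ∀ α i → 2 ℕ.≤ sum α → at α i ℕ.≤ 1 → ∃ λ j → j ≢ i × 1 ℕ.≤ at α j
∃-other α i 2≤ ≤1 with Fin.any? {n = length α} (λ j → ¬? (toℕ j ℕ.≟ i) ×-dec (1 ℕ.≤? at α (toℕ j)))
... | yes (j , j≢i , 1≤) = toℕ j , j≢i , 1≤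
... | no ¬j = ⊥-elim (ℕ.1+n≰n (ℕ.≤-trans 2≤ (subst (ℕ._≤ 1) (sym (sum≡at α i zero-at)) ≤1)))
  where
  zero-at : ∀ j → j ℕ.< length α → j ≢ i → at α j ≡ 0
  zero-at j j< j≢i = ℕ.n<1⇒n≡0 (ℕ.≰⇒> λ 1≤ → ¬j (fromℕ< j< ,
    (λ eq → j≢i (trans (sym (Fin.toℕ-fromℕ< j<)) eq)) , subst (λ k → 1 ℕ.≤ at α k) (sym (Fin.toℕ-fromℕ< j<)) 1≤))

module StarValues {n : ℕ} (G : Graph n) (c : Fin n) (isStar : StarAt c G) where
  open Graph G
  open StarAt isStar
  open OnGraph G
  open Evaluation G
  open Chromatic G

  -- All neighbours of a leaf are the centre, so every vertex of the support is isolated there; with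
  -- a second vertex present, `p-isolated` kills each p_v.
  Q₂-leaves : ∀ γ → (∀ v → at γ (toℕ {n} v) ℕ.≤ 1) → at γ (toℕ c) ≡ 0 → Q₂ γ ≡ 0ℚ
  Q₂-leaves γ γ≤1 c∉γ = cases (2 ℕ.≤? sum γ)
    where
    cases : Dec (2 ℕ.≤ sum γ) → Q₂ γ ≡ 0ℚ
    cases (no 2≰)  = trans (cong (_* Q γ) (indicator-false (2 ℕ.≤? sum γ) 2≰)) (ℚ.*-zeroˡ (Q γ))
    cases (yes 2≤) = trans (cong (≥2? (sum γ) *_) (∑-zero (allFin n) (λ {v} _ → leaf v))) (ℚ.*-zeroʳ (≥2? (sum γ)))
      where
      leaf : ∀ v → p (toℕ v) γ ≡ 0ℚ
      leaf v with v Fin.≟ c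
      ... | yes refl = p-support (toℕ v) γ c∉γ
      ... | no v≢c with ∃-other γ (toℕ v) 2≤ (γ≤1 v)
      ... | j , j≢v , 1≤j = p-isolated {v} j≢v 1≤j λ w v~w →
        [ ⊥-elim ∘ v≢c , (λ { refl → c∉γ }) ]′ (incident v~w)

  -- The centre lies in only one of the two blocks, and the other consists of leaves.
  two-sinks-star : apply (two-sinksᶠ n) (X G) ≡ 0ℚ
  two-sinks-star = trans apply-two-sinks-X (✶-zero (ones n) λ {γ} {δ} sp → term γ δ (Split.at-split sp))
    where
    term : ∀ γ δ → (∀ i → at γ i ℕ.+ at δ i ≡ at (ones n) i) → Q₂ γ * Q₂ δ ≡ 0ℚ
    term γ δ at-s with at γ (toℕ c) in c∈γ
    ... | zero  = trans (cong (_* Q₂ δ) (Q₂-leaves γ γ≤1 c∈γ)) (ℚ.*-zeroˡ (Q₂ δ))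
      where
      γ≤1 : ∀ v → at γ (toℕ v) ℕ.≤ 1
      γ≤1 v = subst (at γ (toℕ v) ℕ.≤_) (trans (at-s (toℕ v)) (at-ones (Fin.toℕ<n v))) (ℕ.m≤m+n (at γ (toℕ v)) (at δ (toℕ v)))
    ... | suc k = trans (cong (Q₂ γ *_) (Q₂-leaves δ δ≤1 c∉δ)) (ℚ.*-zeroʳ (Q₂ γ))
      where
      δ≤1 : ∀ v → at δ (toℕ v) ℕ.≤ 1
      δ≤1 v = subst (at δ (toℕ v) ℕ.≤_) (trans (at-s (toℕ v)) (at-ones (Fin.toℕ<n v))) (ℕ.m≤n+m (at δ (toℕ v)) (at γ (toℕ v)))
      c∉δ : at δ (toℕ c) ≡ 0
      c∉δ = ℕ.m+n≡0⇒n≡0 k (ℕ.suc-injective (trans (cong (ℕ._+ at δ (toℕ c)) (sym c∈γ)) (trans (at-s (toℕ c)) (at-ones (Fin.toℕ<n c)))))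

-- The coefficient of x₁ⁿ⁻¹x₂

leaves-and-centre : ℕ → List ℕ
leaves-and-centre m = m ∷ 1 ∷ []

module _ {m : ℕ} (G : Graph (suc m)) where
  open Graph G
  open OnGraph G
  open Evaluation G
  open Chromatic G

  -- The coefficient requires a stable set of all vertices but one, say c; an edge avoiding c lies
  -- inside that set.
  X-nonstar : (∀ c → Avoidable G c) → X G (leaves-and-centre m) ≡ 0ℚ
  X-nonstar avoid = trans (X≡M (leaves-and-centre m)) (✶-zero (ones (suc m)) λ {γ} {δ} sp →
    trans (cong (_* M [ 1 ] δ) (indicator-false (sₐ? m γ) (no-leaves γ δ sp))) (ℚ.*-zeroˡ (M [ 1 ] δ)))
    where
    no-leaves : ∀ γ δ → Split (ones (suc m)) γ δ → ¬ (Stable γ × sum γ ≡ m)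
    no-leaves γ δ sp ((γ≤1 , indep) , γ≡m) = missing (Fin.any? λ (c : Fin (suc m)) → at γ (toℕ c) ℕ.≟ 0)
      where
      len : length γ ≡ suc m
      len = trans (Split.lengthˡ sp) (length-replicate (suc m))

      δ≡1 : sum δ ≡ 1
      δ≡1 = ℕ.+-cancelˡ-≡ m (sum δ) 1 (trans (cong (ℕ._+ sum δ) (sym γ≡m))
        (trans (Split.sum-split sp) (trans (sum-ones (suc m)) (sym (ℕ.+-comm m 1)))))

      missing : Dec (∃ λ (c : Fin (suc m)) → at γ (toℕ c) ≡ 0) → ⊥
      missing (no full) = ℕ.1+n≢n (trans (sym (sum-ones (suc m))) (trans (cong sum (sym γ≡ones)) γ≡m))
        where
        γ≡ones : γ ≡ ones (suc m)
        γ≡ones = trans (≡ones γ≤1 (λ i i< → ℕ.n≢0⇒n>0 (λ eq →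
            full (fromℕ< (subst (i ℕ.<_) len i<) , trans (cong (at γ) (Fin.toℕ-fromℕ< (subst (i ℕ.<_) len i<))) eq))))
          (cong ones len)
      missing (yes (c , c∉γ)) with avoid c
      ... | u , v , u~v , u≢c , v≢c = indep u v u~v (∈γ u u≢c , ∈γ v v≢c)
        where
        at-one : ∀ x → at γ (toℕ {suc m} x) ℕ.+ at δ (toℕ x) ≡ 1
        at-one x = trans (Split.at-split sp (toℕ x)) (at-ones (Fin.toℕ<n x))

        ∈δ : ∀ x → at γ (toℕ {suc m} x) ≡ 0 → at δ (toℕ x) ≡ 1
        ∈δ x eq = trans (cong (ℕ._+ at δ (toℕ x)) (sym eq)) (at-one x)

        ∈γ : ∀ x → x ≢ c → 1 ℕ.≤ at γ (toℕ x)
        -- A second vertex missing from `γ` would lie in `δ` together with c, but `δ` has total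
        -- degree 1.
        ∈γ x x≢c = ℕ.n≢0⇒n>0 λ x∉γ → ℕ.1+n≰n (subst₂ ℕ._≤_ (cong₂ ℕ._+_ (∈δ x x∉γ) (∈δ c c∉γ)) δ≡1
          (at+at≤sum δ (x≢c ∘ Fin.toℕ-injective)))

  -- All leaves get the first colour and the centre the second; every other term of the product is
  -- nonnegative.
  X-star-pos : ∀ c → StarAt c G → 0ℚ < X G (leaves-and-centre m)
  X-star-pos c isStar = subst (0ℚ <_) (sym (X≡M (leaves-and-centre m)))
    (pos (unbump (toℕ c) (ones (suc m)) (ℕ.≤-reflexive (sym (at-ones (Fin.toℕ<n c))))))
    where
    open StarAt isStar
    open StarSeries G c isStar

    M-nonneg : ∀ α β → 0ℚ ≤ M α β
    M-nonneg []      β = indicator-nonneg (all? (ℕ._≟ 0) β)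
    M-nonneg (a ∷ α) β = ✶-nonneg β λ {γ} {δ} _ → *-nonneg (indicator-nonneg (sₐ? a γ)) (M-nonneg α δ)

    pos : (∃ λ β → ones (suc m) ≡ bump (toℕ c) β) → 0ℚ < M (leaves-and-centre m) (ones (suc m))
    pos (β , eq) = ✶-pos (ones (suc m)) (λ {γ} {δ} _ → *-nonneg (indicator-nonneg (sₐ? m γ)) (M-nonneg [ 1 ] δ))
      (subst (λ α → (β , centre) ∈ splittings α) (sym eq) (∈-splittings (bump (toℕ c) β)
        (split-bumpʳ (toℕ c) c< (subst (λ k → Split β β (zeros k)) len (split-zerosʳ β)))))
      (*-pos (subst (0ℚ <_) (sym leaves≡1) 0<1) (subst (0ℚ <_) (sym centre≡1) 0<1))
      where
      centre = bump (toℕ c) (zeros (suc m))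

      len : length β ≡ suc m
      len = trans (sym (length-bump (toℕ c) β)) (trans (cong length (sym eq)) (length-replicate (suc m)))

      c< : toℕ c ℕ.< length β
      c< = subst (toℕ c ℕ.<_) (sym len) (Fin.toℕ<n c)

      c<′ : toℕ c ℕ.< length (zeros (suc m))
      c<′ = subst (toℕ c ℕ.<_) (sym (length-replicate (suc m))) (Fin.toℕ<n c)

      c∉β : at β (toℕ c) ≡ 0
      c∉β = ℕ.suc-injective (trans (sym (at-bump (toℕ c) β c<)) (trans (cong (λ α → at α (toℕ c)) (sym eq)) (at-ones (Fin.toℕ<n c))))

      leaves≡1 : s m β ≡ 1ℚ
      leaves≡1 = indicator-true (sₐ? m β)
        ( central⇒stable (bump-≤1⁻ (toℕ c) β (subst (All (ℕ._≤ 1)) eq (ones≤1 (suc m)))) (inj₁ c∉β)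
        , ℕ.suc-injective (trans (sym (sum-bump (toℕ c) β c<)) (trans (cong sum (sym eq)) (sum-ones (suc m)))))

      sum-centre : sum centre ≡ 1
      sum-centre = trans (sum-bump (toℕ c) (zeros (suc m)) c<′) (cong suc (sum-zeros (suc m)))

      at-centre : at centre (toℕ c) ≡ 1
      at-centre = trans (at-bump (toℕ c) (zeros (suc m)) c<′) (cong suc (at-zeros (suc m) (toℕ c)))

      centre≡1 : M [ 1 ] centre ≡ 1ℚ
      centre≡1 = trans (✶-identityʳ (s 1) centre) (indicator-true (sₐ? 1 centre)
        ( central⇒stable (bump-≤1 (toℕ c) (at-zeros (suc m) (toℕ c)) (zeros≤1 (suc m))) (inj₂ (trans sum-centre (sym at-centre)))
        , sum-centre))

-- Elementary symmetric functions as series of edgeless graphs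

edgeless : ∀ k → Graph k
edgeless k = record { Adj = λ _ _ → ⊥ ; adj? = λ _ _ → no λ () ; symm = λ () ; irrefl = λ _ () }

module Edgeless (k : ℕ) where
  open OnGraph (edgeless k)
  open Evaluation (edgeless k)

  M-edgeless : ∀ α → M α ≐ ∏ (map e α)
  M-edgeless []      β = refl
  M-edgeless (a ∷ α) β = ✶-cong
    (λ γ → indicator-⇔ (sₐ? a γ) (e? a γ) (λ ((γ≤1 , _) , eq) → γ≤1 , eq) (λ (γ≤1 , eq) → (γ≤1 , λ _ _ ()) , eq))
    (M-edgeless α) β

  -- Transposition turns `μ` from a list of factors into an exponent on an edgeless graph, where the
  -- stable sets of size a give e_a.
  apply-e : ∀ φ μ → apply φ e[ μ ] ≡ ⟦ φ ⟧ μ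
  apply-e φ μ = ∑-cong φ λ cα → cong (proj₁ cα *_)
    (trans (e[]≐∏ μ (proj₂ cα)) (trans (∏e-transpose μ (proj₂ cα)) (sym (M-edgeless (proj₂ cα) μ))))

module _ (μ : List ℕ) {B : ℕ} (μ≤B : sum μ ℕ.≤ B) where
  open OnGraph (edgeless (length μ))
  open Evaluation (edgeless (length μ))
  open Chromatic (edgeless (length μ))
  open Edgeless (length μ)

  sink-e : apply (sinkᶠ B) e[ μ ] ≡ Q μ
  sink-e = trans (apply-e (sinkᶠ B) μ) (⟦sink⟧ B μ refl μ≤B)

  sink-e-nonneg : 0ℚ ≤ apply (sinkᶠ B) e[ μ ]
  sink-e-nonneg = subst (0ℚ ≤_) (sym sink-e) (Q-nonneg μ refl)

  two-sinks-e-nonneg : 0ℚ ≤ apply (two-sinksᶠ B) e[ μ ]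
  two-sinks-e-nonneg = subst (0ℚ ≤_) (sym (trans (apply-e (two-sinksᶠ B) μ) (⟦two-sinks⟧ B μ refl μ≤B)))
    (Q₂✶Q₂-nonneg μ refl)

  -- In an edgeless graph every vertex is isolated, so a second positive part makes each p_v vanish
  -- at `μ`.
  sink-e-zero : (∀ (v : Fin (length μ)) → ∃ λ w → w ≢ toℕ v × 1 ℕ.≤ at μ w) → apply (sinkᶠ B) e[ μ ] ≡ 0ℚ
  sink-e-zero other = trans sink-e (∑-zero (allFin (length μ)) λ {v} _ →
    p-isolated {v} (proj₁ (proj₂ (other v))) (proj₂ (proj₂ (other v))) (λ _ ()))

-- Partitions and expansions in the elementary basis

∈-compositions : ∀ n {μ} → μ ∈ compositions n → All (1 ℕ.≤_) μ × sum μ ≡ n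
∈-compositions zero    (here refl) = [] , refl
∈-compositions (suc n) μ∈ with find (∈-concatMap⁻ _ {xs = compositions n} μ∈)
... | []    , ν∈ , here refl         = s≤s z≤n ∷ [] , cong suc (proj₂ (∈-compositions n ν∈))
... | _ ∷ _ , ν∈ , here refl         = s≤s z≤n ∷ proj₁ (∈-compositions n ν∈) , cong suc (proj₂ (∈-compositions n ν∈))
... | _ ∷ _ , ν∈ , there (here refl) with ∈-compositions n ν∈
...   | _ ∷ ν≥1 , eq = s≤s z≤n ∷ ν≥1 , cong suc eq

∈-partitions : ∀ n {μ} → μ ∈ partitions n → All (1 ℕ.≤_) μ × sum μ ≡ n
∈-partitions n μ∈ = ∈-compositions n (proj₁ (∈-filter⁻ _ {xs = compositions n} μ∈))

e-nonneg : ∀ μ α → 0ℚ ≤ e[ μ ] α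
e-nonneg μ α = subst (0ℚ ≤_) (sym (e[]≐∏ μ α)) (go μ α)
  where
  go : ∀ μ α → 0ℚ ≤ ∏ (map e μ) α
  go []      α = indicator-nonneg (all? (ℕ._≟ 0) α)
  go (m ∷ μ) α = ✶-nonneg α λ {β} {γ} _ → *-nonneg (indicator-nonneg (e? m β)) (go μ γ)

apply-expansion : ∀ {n F} (E : EExpansion n F) φ →
                  apply φ F ≡ ∑ (partitions n) λ μ → coeff E μ * apply φ e[ μ ]
apply-expansion {n} {F} E φ = begin
  ∑ φ (λ x → proj₁ x * F (proj₂ x))
    ≡⟨ ∑-cong φ (λ x → trans (cong (proj₁ x *_) (expands E (proj₂ x)))
         (sym (∑-*ˡ (partitions n) (proj₁ x) (λ μ → coeff E μ * e[ μ ] (proj₂ x))))) ⟩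
  ∑ φ (λ x → ∑ (partitions n) (λ μ → proj₁ x * (coeff E μ * e[ μ ] (proj₂ x))))
    ≡⟨ ∑-swap φ (partitions n) (λ x μ → proj₁ x * (coeff E μ * e[ μ ] (proj₂ x))) ⟩
  ∑ (partitions n) (λ μ → ∑ φ (λ x → proj₁ x * (coeff E μ * e[ μ ] (proj₂ x))))
    ≡⟨ ∑-cong (partitions n) (λ μ → trans
         (∑-cong φ (λ x → solve 3 (λ c k y → (c :* (k :* y)) := (k :* (c :* y))) refl (proj₁ x) (coeff E μ) (e[ μ ] (proj₂ x))))
         (∑-*ˡ φ (coeff E μ) (λ x → proj₁ x * e[ μ ] (proj₂ x)))) ⟩
  ∑ (partitions n) (λ μ → coeff E μ * apply φ e[ μ ]) ∎

apply-⊖ : ∀ φ F r G → apply φ (F ⊖ r · G) ≡ apply φ F - r * apply φ G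
apply-⊖ φ F r G = trans
  (∑-cong φ (λ x → solve 4 (λ c f r g → (c :* (f :+ (:- (r :* g)))) := (c :* f :+ ((:- r) :* (c :* g)))) refl
    (proj₁ x) (F (proj₂ x)) r (G (proj₂ x))))
  (trans (∑-+ φ (λ x → proj₁ x * F (proj₂ x)) (λ x → - r * (proj₁ x * G (proj₂ x))))
    (cong (apply φ F +_) (trans (∑-*ˡ φ (- r) (λ x → proj₁ x * G (proj₂ x)))
      (sym (ℚ.neg-distribˡ-* r (apply φ G))))))

-- `sinkᶠ` is positive on a connected graph and annihilates every e_μ except e_(n), so its value is
-- a nonnegative multiple of the coefficient sought.
coeff-pos : ∀ {n} (G : ConnectedGraph n) → n ≥ 4 → (E : EExpansion n (X (graph G))) → 0ℚ < coeff E [ n ]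
coeff-pos {n} G n≥4 E = *-cancel-pos weight-nonneg
  (subst (0ℚ <_) (trans (apply-expansion E (sinkᶠ n)) (trans (∑-cong-∈ (partitions n) only-[n]) (∑-*ʳ (partitions n) (coeff E [ n ]) weight)))
    (ConnectedChromatic.sink-X-pos (graph G) (connected G) n≥4))
  where
  is-[n]? : ∀ μ → Dec (μ ≡ [ n ])
  is-[n]? μ = ≡-dec ℕ._≟_ μ [ n ]

  -- Marking [ n ] by an indicator, instead of locating it in the list of partitions, lets the whole
  -- sum factor as total weight times coefficient.
  weight : List ℕ → ℚ
  weight μ = indicator (is-[n]? μ) * apply (sinkᶠ n) e[ [ n ] ]

  weight-nonneg : 0ℚ ≤ ∑ (partitions n) weight
  weight-nonneg = ∑-nonneg (partitions n) λ {μ} _ → *-nonneg (indicator-nonneg (is-[n]? μ))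
    (sink-e-nonneg [ n ] (ℕ.≤-reflexive (ℕ.+-identityʳ n)))

  other-part : ∀ {μ} → All (1 ℕ.≤_) μ → sum μ ≡ n → μ ≢ [ n ] → ∀ (v : Fin (length μ)) → ∃ λ w → w ≢ toℕ v × 1 ℕ.≤ at μ w
  other-part {m ∷ []}    _             eq ≢ _       = ⊥-elim (≢ (cong [_] (trans (sym (ℕ.+-identityʳ m)) eq)))
  other-part {_ ∷ _ ∷ _} (_ ∷ 1≤ ∷ _) _  _ zero    = 1 , (λ ()) , 1≤
  other-part {_ ∷ _ ∷ _} (1≤ ∷ _)     _  _ (suc v) = 0 , (λ ()) , 1≤

  only-[n] : ∀ {μ} → μ ∈ partitions n → coeff E μ * apply (sinkᶠ n) e[ μ ] ≡ weight μ * coeff E [ n ]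
  only-[n] {μ} μ∈ = cases (is-[n]? μ)
    where
    cases : Dec (μ ≡ [ n ]) → coeff E μ * apply (sinkᶠ n) e[ μ ] ≡ weight μ * coeff E [ n ]
    cases (yes refl) = trans (ℚ.*-comm (coeff E [ n ]) (apply (sinkᶠ n) e[ [ n ] ])) (cong (_* coeff E [ n ])
      (sym (trans (cong (_* apply (sinkᶠ n) e[ [ n ] ]) (indicator-true (is-[n]? [ n ]) refl)) (ℚ.*-identityˡ (apply (sinkᶠ n) e[ [ n ] ])))))
    cases (no μ≢) = trans
      (trans (cong (coeff E μ *_) (sink-e-zero μ (ℕ.≤-reflexive (proj₂ (∈-partitions n μ∈)))
        (other-part (proj₁ (∈-partitions n μ∈)) (proj₂ (∈-partitions n μ∈)) μ≢))) (ℚ.*-zeroʳ (coeff E μ)))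
      (sym (trans (cong (λ i → i * apply (sinkᶠ n) e[ [ n ] ] * coeff E [ n ]) (indicator-false (is-[n]? μ) μ≢))
        (trans (cong (_* coeff E [ n ]) (ℚ.*-zeroˡ (apply (sinkᶠ n) e[ [ n ] ]))) (ℚ.*-zeroˡ (coeff E [ n ])))))

-- Separation of connected graphs by functionals

÷-pos : ∀ {p q} .{{_ : NonZero q}} → 0ℚ < p → 0ℚ < q → 0ℚ < p ÷ q
÷-pos {p} {q} p>0 q>0 = *-pos p>0 (ℚ.positive⁻¹ _ {{ℚ.1/pos⇒pos q {{positive q>0}}}})

-- A functional nonnegative on every e_μ is nonnegative on an e-positive series, but on X_G - r X_H
-- with r > 0 it takes the value - r φ(X_H) < 0.
separated : ∀ {n} {G H : ConnectedGraph n} → n ≥ 4 → (φ : Functional) →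
            (∀ μ → sum μ ℕ.≤ n → 0ℚ ≤ apply φ e[ μ ]) →
            apply φ (X (graph G)) ≡ 0ℚ → 0ℚ < apply φ (X (graph H)) → ¬ (G ≥ₑ H)
separated {n} {G} {H} n≥4 φ φ≥0 φG≡0 φH>0 G≥H = ℚ.<-irrefl refl (ℚ.<-≤-trans φXₑ<0 φXₑ≥0)
  where
  open _≥ₑ_ G≥H
  E = proj₁ e-positive
  r = coeff expansionᴳ [ n ] ÷ coeff expansionᴴ [ n ]

  φXₑ≥0 : 0ℚ ≤ apply φ Xₑ
  φXₑ≥0 = subst (0ℚ ≤_) (sym (apply-expansion E φ))
    (∑-nonneg (partitions n) λ {μ} μ∈ → *-nonneg (proj₂ e-positive μ∈) (φ≥0 μ (ℕ.≤-reflexive (proj₂ (∈-partitions n μ∈)))))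

  φXₑ≡ : apply φ Xₑ ≡ - (r * apply φ (X (graph H)))
  φXₑ≡ = trans (apply-⊖ φ (X (graph G)) r (X (graph H)))
    (trans (cong (_- r * apply φ (X (graph H))) φG≡0) (ℚ.+-identityˡ _))

  φXₑ<0 : apply φ Xₑ < 0ℚ
  φXₑ<0 = subst (_< 0ℚ) (sym φXₑ≡)
    (ℚ.neg-antimono-< (*-pos (÷-pos (coeff-pos G n≥4 expansionᴳ) (coeff-pos H n≥4 expansionᴴ)) φH>0))

evaluation : List ℕ → Functional
evaluation α = [ 1ℚ , α ]

apply-evaluation : ∀ α F → apply (evaluation α) F ≡ F α
apply-evaluation α F = trans (ℚ.+-identityʳ (1ℚ * F α)) (ℚ.*-identityˡ (F α))

proposition3p13 : ∀ (n : ℕ) → n ≥ 4 → Independent (_∼_ {n}) (_≥ₑ_ {n}) (starGraph n)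
proposition3p13 n@(suc m) n≥4 H star≁H = nonstar (Fin.all? (avoidable? G))
  where
  G = graph H
  c = fromℕ m

  isStar : StarAt c (star n)
  isStar = star-StarAt c (cong suc (Fin.toℕ-fromℕ m))

  nonstar : Dec (∀ c → Avoidable G c) → ¬ (starGraph n ≥ₑ H ⊎ H ≥ₑ starGraph n)
  nonstar (no ¬avoid) with Fin.¬∀⟶∃¬ n (Avoidable G) (avoidable? G) ¬avoid
  -- Every edge of H meets c′, so H is a star and lies in the class of the standard star.
  ... | c′ , ¬avoid-c′ = ⊥-elim (star≁H λ α → trans (X-star (star n) c isStar α)
    (sym (X-star G c′ (unavoidable⇒StarAt G (connected H) c′ ¬avoid-c′) α)))
  nonstar (yes avoid) (inj₁ star≥H) = separated n≥4 (two-sinksᶠ n) (λ μ μ≤n → two-sinks-e-nonneg μ μ≤n)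
    (StarValues.two-sinks-star (star n) c isStar)
    (ConnectedChromatic.two-sinks-X-pos G (connected H) (Growth.disjoint-edges G (connected H) n≥4 avoid))
    star≥H
  -- Here the separating functional is a single coefficient, nonnegative on each e_μ because e_μ has
  -- nonnegative coefficients.
  nonstar (yes avoid) (inj₂ H≥star) = separated n≥4 (evaluation α)
    (λ μ _ → subst (0ℚ ≤_) (sym (apply-evaluation α e[ μ ])) (e-nonneg μ α))
    (trans (apply-evaluation α (X G)) (X-nonstar G avoid))
    (subst (0ℚ <_) (sym (apply-evaluation α (X (star n)))) (X-star-pos (star n) c isStar))
    H≥star
    where α = leaves-and-centre m
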